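{- If $\Gamma\vdash_{\mathrm{PRJ}} t:P$ and $t\to s$, then $\Gamma\vdash_{\mathrm{PRJ}} s:P$.
   Context: Pure types: given a denumerable set of type variables $\alpha,\beta,\dots$, pure types are $A,B ::= \alpha \mid A\wedge B \mid A\vee B \mid A\to B \mid A\ltimes B \mid \neg A \mid \forall\alpha.A \mid \exists\alpha.A$ (quantifiers bind $\alpha$; $A[\alpha:=B]$ capture-avoiding substitution; $\mathrm{ftv}$ free type variables). Types are $P,Q ::= A^{+}\mid A^{ - }\mid A^{\oplus}\mid A^{\ominus}$ (modes only at the root); $A^{+},A^{ - }$ strong, $A^{\oplus},A^{\ominus}$ weak; $B^{\oplus}[\alpha:=A]$ means $(B[\alpha:=A])^{\oplus}$, etc. Opposite type: $(A^{+})^{\sim}=A^{ - }$, $(A^{ - })^{\sim}=A^{+}$, $(A^{\oplus})^{\sim}=A^{\ominus}$, $(A^{\ominus})^{\sim}=A^{\oplus}$. Terms ($\varepsilon\in\{+,-\}$, $i\in\{1,2\}$): $t,s,u ::= x \mid t \mathbin{\#}^{P} s \mid \lambda^{\varepsilon}_{\circ}(x:P).t \mid t \circ^{\varepsilon} s \mid \langle t,s\rangle^{\varepsilon} \mid \pi^{\varepsilon}_i(t) \mid \mathrm{in}^{\varepsilon}_i(t) \mid \mathrm{case}^{\varepsilon}\, t\,[x:P.\,s \mid y:Q.\,u] \mid \lambda^{\varepsilon}(x:P).t \mid t @^{\varepsilon} s \mid \langle\!\langle t,s\rangle\!\rangle^{\varepsilon} \mid \mathrm{colam}^{\varepsilon}\,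 t\,[x:P,y:Q.\,s] \mid \neg\mathrm{I}^{\varepsilon}(t) \mid \neg\mathrm{E}^{\varepsilon}(t) \mid \Lambda^{\varepsilon}\alpha.t \mid t[A]^{\varepsilon} \mid \langle A,t\rangle^{\varepsilon} \mid \mathrm{open}^{\varepsilon}\, t \text{ as } (\alpha,x:P) \text{ in } s$, with evident binders, up to $\alpha$-renaming; $t[x:=s]$, $t[\alpha:=A]$ capture-avoiding substitutions. A typing context $\Gamma$ is a finite assignment $x_1:P_1,\dots,x_n:P_n$. Typing judgments $\Gamma\vdash t:P$ of $\lambda^{\mathrm{PRK}}$ are derived by the rules: (Ax) $\Gamma,x:P\vdash x:P$. (Abs) if $\Gamma\vdash t:A^{+}$ and $\Gamma\vdash s:A^{ - }$ then $\Gamma\vdash t\mathbin{\#}^{P}s:P$ for any $P$. (Weak) if $\Gamma,x:A^{\ominus}\vdash t:A^{+}$ then $\Gamma\vdash\lambda^{+}_{\circ}(x:A^{\ominus}).t:A^{\oplus}$; if $\Gamma,x:A^{\oplus}\vdash t:A^{ - }$ then $\Gamma\vdash\lambda^{ - }_{\circ}(x:A^{\oplus}).t:A^{\ominus}$; if $\Gamma\vdash t:A^{\oplus}$, $\Gamma\vdash s:A^{\ominus}$ then $\Gamma\vdash t\circ^{+}s:A^{+}$; if $\Gamma\vdash t:A^{\ominus}$, $\Gamma\vdash s:A^{\oplus}$ then $\Gamma\vdash t\circ^{ - }s:A^{ - }$. (Pairs) from $t:A^{\oplus}$, $s:B^{\oplus}$ infer $\langle t,s\rangle^{+}:(A\wedge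 B)^{+}$; from $t:A^{\ominus}$, $s:B^{\ominus}$ infer $\langle t,s\rangle^{ - }:(A\vee B)^{ - }$; from $t:(A_1\wedge A_2)^{+}$ infer $\pi^{+}_i(t):A_i^{\oplus}$; from $t:(A_1\vee A_2)^{ - }$ infer $\pi^{ - }_i(t):A_i^{\ominus}$ (same $\Gamma$ throughout). (Injections) from $t:A_i^{\oplus}$ infer $\mathrm{in}^{+}_i(t):(A_1\vee A_2)^{+}$; from $t:A_i^{\ominus}$ infer $\mathrm{in}^{ - }_i(t):(A_1\wedge A_2)^{ - }$; if $\Gamma\vdash t:(A\vee B)^{+}$, $\Gamma,x:A^{\oplus}\vdash s:P$, $\Gamma,y:B^{\oplus}\vdash u:P$ then $\Gamma\vdash\mathrm{case}^{+}t[x:A^{\oplus}.s\mid y:B^{\oplus}.u]:P$; if $\Gamma\vdash t:(A\wedge B)^{ - }$, $\Gamma,x:A^{\ominus}\vdash s:P$, $\Gamma,y:B^{\ominus}\vdash u:P$ then $\Gamma\vdash\mathrm{case}^{ - }t[x:A^{\ominus}.s\mid y:B^{\ominus}.u]:P$. (Implication/co-implication) if $\Gamma,x:A^{\oplus}\vdash t:B^{\oplus}$ then $\Gamma\vdash\lambda^{+}(x:A^{\oplus}).t:(A\to B)^{+}$; if $\Gamma,x:A^{\ominus}\vdash t:B^{\ominus}$ then $\Gamma\vdash\lambda^{ - }(x:A^{\ominus}).t:(A\ltimes B)^{ - }$; from $t:(A\to B)^{+}$, $s:A^{\oplus}$ infer $t@^{+}s:B^{\oplus}$; from $t:(A\ltimes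 B)^{ - }$, $s:A^{\ominus}$ infer $t@^{ - }s:B^{\ominus}$; from $t:A^{\ominus}$, $s:B^{\oplus}$ infer $\langle\!\langle t,s\rangle\!\rangle^{+}:(A\ltimes B)^{+}$; from $t:A^{\oplus}$, $s:B^{\ominus}$ infer $\langle\!\langle t,s\rangle\!\rangle^{ - }:(A\to B)^{ - }$; if $\Gamma\vdash t:(A\ltimes B)^{+}$ and $\Gamma,x:A^{\ominus},y:B^{\oplus}\vdash s:P$ then $\Gamma\vdash\mathrm{colam}^{+}t[x:A^{\ominus},y:B^{\oplus}.s]:P$; if $\Gamma\vdash t:(A\to B)^{ - }$ and $\Gamma,x:A^{\oplus},y:B^{\ominus}\vdash s:P$ then $\Gamma\vdash\mathrm{colam}^{ - }t[x:A^{\oplus},y:B^{\ominus}.s]:P$. (Negation) from $t:A^{\ominus}$ infer $\neg\mathrm{I}^{+}(t):(\neg A)^{+}$; from $t:A^{\oplus}$ infer $\neg\mathrm{I}^{ - }(t):(\neg A)^{ - }$; from $t:(\neg A)^{+}$ infer $\neg\mathrm{E}^{+}(t):A^{\ominus}$; from $t:(\neg A)^{ - }$ infer $\neg\mathrm{E}^{ - }(t):A^{\oplus}$. (Quantifiers) if $\Gamma\vdash t:A^{\oplus}$, $\alpha\notin\mathrm{ftv}(\Gamma)$ then $\Gamma\vdash\Lambda^{+}\alpha.t:(\forall\alpha.A)^{+}$; if $\Gamma\vdash t:A^{\ominus}$, $\alpha\notin\mathrm{ftv}(\Gamma)$ then $\Gamma\vdash\Lambda^{ - }\alpha.t:(\exists\alpha.A)^{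 - }$; from $t:(\forall\alpha.B)^{+}$ infer $t[A]^{+}:B^{\oplus}[\alpha:=A]$; from $t:(\exists\alpha.B)^{ - }$ infer $t[A]^{ - }:B^{\ominus}[\alpha:=A]$; from $t:B^{\oplus}[\alpha:=A]$ infer $\langle A,t\rangle^{+}:(\exists\alpha.B)^{+}$; from $t:B^{\ominus}[\alpha:=A]$ infer $\langle A,t\rangle^{ - }:(\forall\alpha.B)^{ - }$; if $\Gamma\vdash t:(\exists\alpha.A)^{+}$, $\Gamma,x:A^{\oplus}\vdash s:P$, $\alpha\notin\mathrm{ftv}(\Gamma,P)$ then $\Gamma\vdash\mathrm{open}^{+}t\text{ as }(\alpha,x:A^{\oplus})\text{ in }s:P$; if $\Gamma\vdash t:(\forall\alpha.A)^{ - }$, $\Gamma,x:A^{\ominus}\vdash s:P$, $\alpha\notin\mathrm{ftv}(\Gamma,P)$ then $\Gamma\vdash\mathrm{open}^{ - }t\text{ as }(\alpha,x:A^{\ominus})\text{ in }s:P$. Generalized absurdity: if $\Gamma\vdash t:P$ and $\Gamma\vdash s:P^{\sim}$, $t\mathbin{\#\!\#}^{Q}s$ is $t\mathbin{\#}^{Q}s$ if $P=A^{+}$; $s\mathbin{\#}^{Q}t$ if $P=A^{ - }$; $(t\circ^{+}s)\mathbin{\#}^{Q}(s\circ^{ - }t)$ if $P=A^{\oplus}$; $(s\circ^{+}t)\mathbin{\#}^{Q}(t\circ^{ - }s)$ if $P=A^{\ominus}$. Reduction $\to$: relation on typable terms given by the following rules closed under arbitrary contexts (all $\varepsilon$ in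 a rule equal; annotations omitted, the annotation of $\#$ kept): $(\lambda^{\varepsilon}_{\circ}x.t)\circ^{\varepsilon}s\to t[x:=s]$; $\pi^{\varepsilon}_i\langle t_1,t_2\rangle^{\varepsilon}\to t_i$; $\mathrm{case}^{\varepsilon}(\mathrm{in}^{\varepsilon}_i t)[x.s_1\mid x.s_2]\to s_i[x:=t]$; $(\lambda^{\varepsilon}x.t)@^{\varepsilon}s\to t[x:=s]$; $\mathrm{colam}^{\varepsilon}\langle\!\langle t,s\rangle\!\rangle^{\varepsilon}[x,y.u]\to u[x:=t][y:=s]$; $\neg\mathrm{E}^{\varepsilon}(\neg\mathrm{I}^{\varepsilon}t)\to t$; $(\Lambda^{\varepsilon}\alpha.t)[A]^{\varepsilon}\to t[\alpha:=A]$; $\mathrm{open}^{\varepsilon}\langle A,t\rangle^{\varepsilon}\text{ as }(\alpha,x)\text{ in }s\to s[\alpha:=A][x:=t]$; $\langle t_1,t_2\rangle^{+}\mathbin{\#}\mathrm{in}^{ - }_i s\to t_i\mathbin{\#\!\#}s$; $\mathrm{in}^{+}_i t\mathbin{\#}\langle s_1,s_2\rangle^{ - }\to t\mathbin{\#\!\#}s_i$; $(\lambda^{+}x.t)\mathbin{\#}\langle\!\langle s,u\rangle\!\rangle^{ - }\to t[x:=s]\mathbin{\#\!\#}u$; $\langle\!\langle t,s\rangle\!\rangle^{+}\mathbin{\#}(\lambda^{ - }x.u)\to s\mathbin{\#\!\#}u[x:=t]$; $(\neg\mathrm{I}^{+}t)\mathbin{\#}(\neg\mathrm{I}^{ - }s)\to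 t\mathbin{\#\!\#}s$; $(\Lambda^{+}\alpha.t)\mathbin{\#}\langle A,s\rangle^{ - }\to t[\alpha:=A]\mathbin{\#\!\#}s$; $\langle A,t\rangle^{+}\mathbin{\#}(\Lambda^{ - }\alpha.s)\to t\mathbin{\#\!\#}s[\alpha:=A]$. Intuitionistic terms: an occurrence of a subterm (or of a variable) in a term $t$ is useless if it lies inside the argument $s$ of some subterm of $t$ of the form $u\circ^{+}s$ (a positive weak elimination); otherwise it is useful. A term $t$ is intuitionistic iff (1) $t$ has no useful subterm of any of the forms $\mathrm{case}^{ - }\,r\,[x.s\mid y.u]$, $\mathrm{colam}^{ - }\,r\,[x,y.s]$, $\neg\mathrm{E}^{ - }(r)$, $\mathrm{open}^{ - }\,r\text{ as }(\alpha,x)\text{ in }s$; and (2) for every useful subterm of the form $\lambda^{+}_{\circ}(x:A^{\ominus}).r$, there is no useful occurrence of $x$ in $r$. We write $\Gamma\vdash_{\mathrm{PRJ}} t:P$ iff $\Gamma\vdash t:P$ is derivable in $\lambda^{\mathrm{PRK}}$ and $t$ is intuitionistic. -}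

module Defs where

-- The calculus λ^PRK / λ^PRJ, with de Bruijn indices for both type
-- variables and term variables (terms and types up to α-renaming).

open import Data.Nat using (ℕ; zero; suc)
open import Data.List using (List; []; _∷_; map)
open import Data.Product using (_×_)
open import Data.Unit using (⊤)
open import Data.Empty using (⊥)
open import Relation.Binary.PropositionalEquality using (_≢_)

-- Pure types  A ::= α | A ∧ B | A ∨ B | A → B | A ⋉ B | ¬ A | ∀α.A | ∃α.A
-- (tvar n is the de Bruijn index of a type variable; ∀ᵗ / ∃ᵗ bind index 0)

infixr 12 _∧ᵗ_
infixr 11 _∨ᵗ_
infixr 10 _⇒ᵗ_ _⋉ᵗ_

data Ty : Set where
  tvar        : ℕ → Ty
  _∧ᵗ_ _∨ᵗ_   : Ty → Ty → Ty
  _⇒ᵗ_ _⋉ᵗ_   : Ty → Ty → Ty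
  ¬ᵗ_         : Ty → Ty
  ∀ᵗ ∃ᵗ       : Ty → Ty

-- Modes:  ⁺ = strong positive (+), ⁻ = strong negative (-),
--         ⊕ = weak positive, ⊖ = weak negative
data Mode : Set where
  ⁺ ⁻ ⊕ ⊖ : Mode

infix 8 _^_
data MTy : Set where
  _^_ : Ty → Mode → MTy

data Sign : Set where
  pos neg : Sign

data Idx : Set where
  i₁ i₂ : Idx

sel : {X : Set} → Idx → X → X → X
sel i₁ a b = a
sel i₂ a b = b

extR : (ℕ → ℕ) → ℕ → ℕ
extR ρ zero    = zero
extR ρ (suc n) = suc (ρ n)

tren : (ℕ → ℕ) → Ty → Ty
tren ρ (tvar n)  = tvar (ρ n)
tren ρ (A ∧ᵗ B)  = tren ρ A ∧ᵗ tren ρ B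
tren ρ (A ∨ᵗ B)  = tren ρ A ∨ᵗ tren ρ B
tren ρ (A ⇒ᵗ B)  = tren ρ A ⇒ᵗ tren ρ B
tren ρ (A ⋉ᵗ B)  = tren ρ A ⋉ᵗ tren ρ B
tren ρ (¬ᵗ A)    = ¬ᵗ tren ρ A
tren ρ (∀ᵗ A)    = ∀ᵗ (tren (extR ρ) A)
tren ρ (∃ᵗ A)    = ∃ᵗ (tren (extR ρ) A)

textS : (ℕ → Ty) → ℕ → Ty
textS σ zero    = tvar zero
textS σ (suc n) = tren suc (σ n)

tsub : (ℕ → Ty) → Ty → Ty
tsub σ (tvar n)  = σ n
tsub σ (A ∧ᵗ B)  = tsub σ A ∧ᵗ tsub σ B
tsub σ (A ∨ᵗ B)  = tsub σ A ∨ᵗ tsub σ B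
tsub σ (A ⇒ᵗ B)  = tsub σ A ⇒ᵗ tsub σ B
tsub σ (A ⋉ᵗ B)  = tsub σ A ⋉ᵗ tsub σ B
tsub σ (¬ᵗ A)    = ¬ᵗ tsub σ A
tsub σ (∀ᵗ A)    = ∀ᵗ (tsub (textS σ) A)
tsub σ (∃ᵗ A)    = ∃ᵗ (tsub (textS σ) A)

tsingle : Ty → ℕ → Ty
tsingle A zero    = A
tsingle A (suc n) = tvar n

_[_]ᵗ : Ty → Ty → Ty
B [ A ]ᵗ = tsub (tsingle A) B

mren : (ℕ → ℕ) → MTy → MTy
mren ρ (A ^ m) = tren ρ A ^ m

msub : (ℕ → Ty) → MTy → MTy
msub σ (A ^ m) = tsub σ A ^ m

-- shift all free type variables by one (used for the condition α ∉ ftv)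
mshift : MTy → MTy
mshift = mren suc

-- Terms (annotations are kept on binders, on # and on case/colam/open)

data Tm : Set where
  var    : ℕ → Tm
  abs    : MTy → Tm → Tm → Tm                 -- t #^P s        (abs P t s)
  wlam   : Sign → MTy → Tm → Tm               -- λ^ε_∘ (x:P). t
  wapp   : Sign → Tm → Tm → Tm                -- t ∘^ε s
  pair   : Sign → Tm → Tm → Tm
  proj   : Sign → Idx → Tm → Tm
  inj    : Sign → Idx → Tm → Tm
  case   : Sign → Tm → MTy → Tm → MTy → Tm → Tm
  lam    : Sign → MTy → Tm → Tm
  app    : Sign → Tm → Tm → Tm
  copair : Sign → Tm → Tm → Tm
  colam  : Sign → Tm → MTy → MTy → Tm → Tm    -- colam^ε t [x:P, y:Q. s]
                                              -- (in s: y = index 0, x = index 1)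
  negI   : Sign → Tm → Tm
  negE   : Sign → Tm → Tm
  tlam   : Sign → Tm → Tm
  tapp   : Sign → Tm → Ty → Tm
  pack   : Sign → Ty → Tm → Tm
  open′  : Sign → Tm → MTy → Tm → Tm          -- open^ε t as (α, x:P) in s
                                              -- (α bound in P and s; x = index 0 in s)

tyRen : (ℕ → ℕ) → Tm → Tm
tyRen ρ (var x)            = var x
tyRen ρ (abs P t s)        = abs (mren ρ P) (tyRen ρ t) (tyRen ρ s)
tyRen ρ (wlam e P t)       = wlam e (mren ρ P) (tyRen ρ t)
tyRen ρ (wapp e t s)       = wapp e (tyRen ρ t) (tyRen ρ s)
tyRen ρ (pair e t s)       = pair e (tyRen ρ t) (tyRen ρ s)
tyRen ρ (proj e i t)       = proj e i (tyRen ρ t)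
tyRen ρ (inj e i t)        = inj e i (tyRen ρ t)
tyRen ρ (case e t P s Q u) = case e (tyRen ρ t) (mren ρ P) (tyRen ρ s) (mren ρ Q) (tyRen ρ u)
tyRen ρ (lam e P t)        = lam e (mren ρ P) (tyRen ρ t)
tyRen ρ (app e t s)        = app e (tyRen ρ t) (tyRen ρ s)
tyRen ρ (copair e t s)     = copair e (tyRen ρ t) (tyRen ρ s)
tyRen ρ (colam e t P Q s)  = colam e (tyRen ρ t) (mren ρ P) (mren ρ Q) (tyRen ρ s)
tyRen ρ (negI e t)         = negI e (tyRen ρ t)
tyRen ρ (negE e t)         = negE e (tyRen ρ t)
tyRen ρ (tlam e t)         = tlam e (tyRen (extR ρ) t)
tyRen ρ (tapp e t A)       = tapp e (tyRen ρ t) (tren ρ A)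
tyRen ρ (pack e A t)       = pack e (tren ρ A) (tyRen ρ t)
tyRen ρ (open′ e t P s)    = open′ e (tyRen ρ t) (mren (extR ρ) P) (tyRen (extR ρ) s)

tySub : (ℕ → Ty) → Tm → Tm
tySub σ (var x)            = var x
tySub σ (abs P t s)        = abs (msub σ P) (tySub σ t) (tySub σ s)
tySub σ (wlam e P t)       = wlam e (msub σ P) (tySub σ t)
tySub σ (wapp e t s)       = wapp e (tySub σ t) (tySub σ s)
tySub σ (pair e t s)       = pair e (tySub σ t) (tySub σ s)
tySub σ (proj e i t)       = proj e i (tySub σ t)
tySub σ (inj e i t)        = inj e i (tySub σ t)
tySub σ (case e t P s Q u) = case e (tySub σ t) (msub σ P) (tySub σ s) (msub σ Q) (tySub σ u)
tySub σ (lam e P t)        = lam e (msub σ P) (tySub σ t)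
tySub σ (app e t s)        = app e (tySub σ t) (tySub σ s)
tySub σ (copair e t s)     = copair e (tySub σ t) (tySub σ s)
tySub σ (colam e t P Q s)  = colam e (tySub σ t) (msub σ P) (msub σ Q) (tySub σ s)
tySub σ (negI e t)         = negI e (tySub σ t)
tySub σ (negE e t)         = negE e (tySub σ t)
tySub σ (tlam e t)         = tlam e (tySub (textS σ) t)
tySub σ (tapp e t A)       = tapp e (tySub σ t) (tsub σ A)
tySub σ (pack e A t)       = pack e (tsub σ A) (tySub σ t)
tySub σ (open′ e t P s)    = open′ e (tySub σ t) (msub (textS σ) P) (tySub (textS σ) s)

_[_]ᵀ : Tm → Ty → Tm
t [ A ]ᵀ = tySub (tsingle A) t

ren : (ℕ → ℕ) → Tm → Tm
ren ρ (var x)            = var (ρ x)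
ren ρ (abs P t s)        = abs P (ren ρ t) (ren ρ s)
ren ρ (wlam e P t)       = wlam e P (ren (extR ρ) t)
ren ρ (wapp e t s)       = wapp e (ren ρ t) (ren ρ s)
ren ρ (pair e t s)       = pair e (ren ρ t) (ren ρ s)
ren ρ (proj e i t)       = proj e i (ren ρ t)
ren ρ (inj e i t)        = inj e i (ren ρ t)
ren ρ (case e t P s Q u) = case e (ren ρ t) P (ren (extR ρ) s) Q (ren (extR ρ) u)
ren ρ (lam e P t)        = lam e P (ren (extR ρ) t)
ren ρ (app e t s)        = app e (ren ρ t) (ren ρ s)
ren ρ (copair e t s)     = copair e (ren ρ t) (ren ρ s)
ren ρ (colam e t P Q s)  = colam e (ren ρ t) P Q (ren (extR (extR ρ)) s)
ren ρ (negI e t)         = negI e (ren ρ t)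
ren ρ (negE e t)         = negE e (ren ρ t)
ren ρ (tlam e t)         = tlam e (ren ρ t)
ren ρ (tapp e t A)       = tapp e (ren ρ t) A
ren ρ (pack e A t)       = pack e A (ren ρ t)
ren ρ (open′ e t P s)    = open′ e (ren ρ t) P (ren (extR ρ) s)

extS : (ℕ → Tm) → ℕ → Tm
extS σ zero    = var zero
extS σ (suc n) = ren suc (σ n)

tyExtS : (ℕ → Tm) → ℕ → Tm
tyExtS σ n = tyRen suc (σ n)

sub : (ℕ → Tm) → Tm → Tm
sub σ (var x)            = σ x
sub σ (abs P t s)        = abs P (sub σ t) (sub σ s)
sub σ (wlam e P t)       = wlam e P (sub (extS σ) t)
sub σ (wapp e t s)       = wapp e (sub σ t) (sub σ s)
sub σ (pair e t s)       = pair e (sub σ t) (sub σ s)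
sub σ (proj e i t)       = proj e i (sub σ t)
sub σ (inj e i t)        = inj e i (sub σ t)
sub σ (case e t P s Q u) = case e (sub σ t) P (sub (extS σ) s) Q (sub (extS σ) u)
sub σ (lam e P t)        = lam e P (sub (extS σ) t)
sub σ (app e t s)        = app e (sub σ t) (sub σ s)
sub σ (copair e t s)     = copair e (sub σ t) (sub σ s)
sub σ (colam e t P Q s)  = colam e (sub σ t) P Q (sub (extS (extS σ)) s)
sub σ (negI e t)         = negI e (sub σ t)
sub σ (negE e t)         = negE e (sub σ t)
sub σ (tlam e t)         = tlam e (sub (tyExtS σ) t)
sub σ (tapp e t A)       = tapp e (sub σ t) A
sub σ (pack e A t)       = pack e A (sub σ t)
sub σ (open′ e t P s)    = open′ e (sub σ t) P (sub (extS (tyExtS σ)) s)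

single : Tm → ℕ → Tm
single s zero    = s
single s (suc n) = var n

_[_]ᵐ : Tm → Tm → Tm
t [ s ]ᵐ = sub (single s) t

-- u[x:=t][y:=s] for the body u of colam (y = index 0, x = index 1)
double : Tm → Tm → ℕ → Tm
double t s zero          = s
double t s (suc zero)    = t
double t s (suc (suc n)) = var n

-- Generalized absurdity  t ##^Q s, by the mode of the type P of t

gabs : Mode → MTy → Tm → Tm → Tm
gabs ⁺ Q t s = abs Q t s
gabs ⁻ Q t s = abs Q s t
gabs ⊕ Q t s = abs Q (wapp pos t s) (wapp neg s t)
gabs ⊖ Q t s = abs Q (wapp pos s t) (wapp neg t s)

Ctx : Set
Ctx = List MTy

-- shifting the free type variables of a context (de Bruijn rendering of
-- the side condition α ∉ ftv(Γ))
shiftCtx : Ctx → Ctx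
shiftCtx = map mshift

infix 4 _∋_⦂_
data _∋_⦂_ : Ctx → ℕ → MTy → Set where
  here  : ∀ {Γ P} → (P ∷ Γ) ∋ zero ⦂ P
  there : ∀ {Γ P Q n} → Γ ∋ n ⦂ P → (Q ∷ Γ) ∋ suc n ⦂ P

infix 4 _⊢_⦂_
data _⊢_⦂_ : Ctx → Tm → MTy → Set where
  ax      : ∀ {Γ x P} → Γ ∋ x ⦂ P → Γ ⊢ var x ⦂ P
  absurd  : ∀ {Γ t s A P} → Γ ⊢ t ⦂ A ^ ⁺ → Γ ⊢ s ⦂ A ^ ⁻ → Γ ⊢ abs P t s ⦂ P
  wlam⁺   : ∀ {Γ t A} → (A ^ ⊖ ∷ Γ) ⊢ t ⦂ A ^ ⁺ → Γ ⊢ wlam pos (A ^ ⊖) t ⦂ A ^ ⊕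
  wlam⁻   : ∀ {Γ t A} → (A ^ ⊕ ∷ Γ) ⊢ t ⦂ A ^ ⁻ → Γ ⊢ wlam neg (A ^ ⊕) t ⦂ A ^ ⊖
  wapp⁺   : ∀ {Γ t s A} → Γ ⊢ t ⦂ A ^ ⊕ → Γ ⊢ s ⦂ A ^ ⊖ → Γ ⊢ wapp pos t s ⦂ A ^ ⁺
  wapp⁻   : ∀ {Γ t s A} → Γ ⊢ t ⦂ A ^ ⊖ → Γ ⊢ s ⦂ A ^ ⊕ → Γ ⊢ wapp neg t s ⦂ A ^ ⁻
  pair⁺   : ∀ {Γ t s A B} → Γ ⊢ t ⦂ A ^ ⊕ → Γ ⊢ s ⦂ B ^ ⊕ → Γ ⊢ pair pos t s ⦂ (A ∧ᵗ B) ^ ⁺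
  pair⁻   : ∀ {Γ t s A B} → Γ ⊢ t ⦂ A ^ ⊖ → Γ ⊢ s ⦂ B ^ ⊖ → Γ ⊢ pair neg t s ⦂ (A ∨ᵗ B) ^ ⁻
  proj⁺   : ∀ {Γ t A₁ A₂} (i : Idx) → Γ ⊢ t ⦂ (A₁ ∧ᵗ A₂) ^ ⁺ → Γ ⊢ proj pos i t ⦂ sel i A₁ A₂ ^ ⊕
  proj⁻   : ∀ {Γ t A₁ A₂} (i : Idx) → Γ ⊢ t ⦂ (A₁ ∨ᵗ A₂) ^ ⁻ → Γ ⊢ proj neg i t ⦂ sel i A₁ A₂ ^ ⊖
  inj⁺    : ∀ {Γ t A₁ A₂} (i : Idx) → Γ ⊢ t ⦂ sel i A₁ A₂ ^ ⊕ → Γ ⊢ inj pos i t ⦂ (A₁ ∨ᵗ A₂) ^ ⁺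
  inj⁻    : ∀ {Γ t A₁ A₂} (i : Idx) → Γ ⊢ t ⦂ sel i A₁ A₂ ^ ⊖ → Γ ⊢ inj neg i t ⦂ (A₁ ∧ᵗ A₂) ^ ⁻
  case⁺   : ∀ {Γ t s u A B P} → Γ ⊢ t ⦂ (A ∨ᵗ B) ^ ⁺ → (A ^ ⊕ ∷ Γ) ⊢ s ⦂ P → (B ^ ⊕ ∷ Γ) ⊢ u ⦂ P
            → Γ ⊢ case pos t (A ^ ⊕) s (B ^ ⊕) u ⦂ P
  case⁻   : ∀ {Γ t s u A B P} → Γ ⊢ t ⦂ (A ∧ᵗ B) ^ ⁻ → (A ^ ⊖ ∷ Γ) ⊢ s ⦂ P → (B ^ ⊖ ∷ Γ) ⊢ u ⦂ P
            → Γ ⊢ case neg t (A ^ ⊖) s (B ^ ⊖) u ⦂ P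
  lam⁺    : ∀ {Γ t A B} → (A ^ ⊕ ∷ Γ) ⊢ t ⦂ B ^ ⊕ → Γ ⊢ lam pos (A ^ ⊕) t ⦂ (A ⇒ᵗ B) ^ ⁺
  lam⁻    : ∀ {Γ t A B} → (A ^ ⊖ ∷ Γ) ⊢ t ⦂ B ^ ⊖ → Γ ⊢ lam neg (A ^ ⊖) t ⦂ (A ⋉ᵗ B) ^ ⁻
  app⁺    : ∀ {Γ t s A B} → Γ ⊢ t ⦂ (A ⇒ᵗ B) ^ ⁺ → Γ ⊢ s ⦂ A ^ ⊕ → Γ ⊢ app pos t s ⦂ B ^ ⊕
  app⁻    : ∀ {Γ t s A B} → Γ ⊢ t ⦂ (A ⋉ᵗ B) ^ ⁻ → Γ ⊢ s ⦂ A ^ ⊖ → Γ ⊢ app neg t s ⦂ B ^ ⊖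
  copair⁺ : ∀ {Γ t s A B} → Γ ⊢ t ⦂ A ^ ⊖ → Γ ⊢ s ⦂ B ^ ⊕ → Γ ⊢ copair pos t s ⦂ (A ⋉ᵗ B) ^ ⁺
  copair⁻ : ∀ {Γ t s A B} → Γ ⊢ t ⦂ A ^ ⊕ → Γ ⊢ s ⦂ B ^ ⊖ → Γ ⊢ copair neg t s ⦂ (A ⇒ᵗ B) ^ ⁻
  colam⁺  : ∀ {Γ t s A B P} → Γ ⊢ t ⦂ (A ⋉ᵗ B) ^ ⁺ → (B ^ ⊕ ∷ A ^ ⊖ ∷ Γ) ⊢ s ⦂ P
            → Γ ⊢ colam pos t (A ^ ⊖) (B ^ ⊕) s ⦂ P
  colam⁻  : ∀ {Γ t s A B P} → Γ ⊢ t ⦂ (A ⇒ᵗ B) ^ ⁻ → (B ^ ⊖ ∷ A ^ ⊕ ∷ Γ) ⊢ s ⦂ P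
            → Γ ⊢ colam neg t (A ^ ⊕) (B ^ ⊖) s ⦂ P
  negI⁺   : ∀ {Γ t A} → Γ ⊢ t ⦂ A ^ ⊖ → Γ ⊢ negI pos t ⦂ (¬ᵗ A) ^ ⁺
  negI⁻   : ∀ {Γ t A} → Γ ⊢ t ⦂ A ^ ⊕ → Γ ⊢ negI neg t ⦂ (¬ᵗ A) ^ ⁻
  negE⁺   : ∀ {Γ t A} → Γ ⊢ t ⦂ (¬ᵗ A) ^ ⁺ → Γ ⊢ negE pos t ⦂ A ^ ⊖
  negE⁻   : ∀ {Γ t A} → Γ ⊢ t ⦂ (¬ᵗ A) ^ ⁻ → Γ ⊢ negE neg t ⦂ A ^ ⊕
  tlam⁺   : ∀ {Γ t A} → shiftCtx Γ ⊢ t ⦂ A ^ ⊕ → Γ ⊢ tlam pos t ⦂ (∀ᵗ A) ^ ⁺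
  tlam⁻   : ∀ {Γ t A} → shiftCtx Γ ⊢ t ⦂ A ^ ⊖ → Γ ⊢ tlam neg t ⦂ (∃ᵗ A) ^ ⁻
  tapp⁺   : ∀ {Γ t B} (A : Ty) → Γ ⊢ t ⦂ (∀ᵗ B) ^ ⁺ → Γ ⊢ tapp pos t A ⦂ (B [ A ]ᵗ) ^ ⊕
  tapp⁻   : ∀ {Γ t B} (A : Ty) → Γ ⊢ t ⦂ (∃ᵗ B) ^ ⁻ → Γ ⊢ tapp neg t A ⦂ (B [ A ]ᵗ) ^ ⊖
  pack⁺   : ∀ {Γ t B} (A : Ty) → Γ ⊢ t ⦂ (B [ A ]ᵗ) ^ ⊕ → Γ ⊢ pack pos A t ⦂ (∃ᵗ B) ^ ⁺
  pack⁻   : ∀ {Γ t B} (A : Ty) → Γ ⊢ t ⦂ (B [ A ]ᵗ) ^ ⊖ → Γ ⊢ pack neg A t ⦂ (∀ᵗ B) ^ ⁻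
  open⁺   : ∀ {Γ t s A P} → Γ ⊢ t ⦂ (∃ᵗ A) ^ ⁺ → (A ^ ⊕ ∷ shiftCtx Γ) ⊢ s ⦂ mshift P
            → Γ ⊢ open′ pos t (A ^ ⊕) s ⦂ P
  open⁻   : ∀ {Γ t s A P} → Γ ⊢ t ⦂ (∀ᵗ A) ^ ⁻ → (A ^ ⊖ ∷ shiftCtx Γ) ⊢ s ⦂ mshift P
            → Γ ⊢ open′ neg t (A ^ ⊖) s ⦂ P

infix 4 _↦_
data _↦_ : Tm → Tm → Set where
  β-weak   : ∀ {e P t s} → wapp e (wlam e P t) s ↦ t [ s ]ᵐ
  β-pair   : ∀ {e i t₁ t₂} → proj e i (pair e t₁ t₂) ↦ sel i t₁ t₂
  β-case   : ∀ {e i t P s₁ Q s₂} → case e (inj e i t) P s₁ Q s₂ ↦ (sel i s₁ s₂) [ t ]ᵐ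
  β-lam    : ∀ {e P t s} → app e (lam e P t) s ↦ t [ s ]ᵐ
  β-colam  : ∀ {e t s P Q u} → colam e (copair e t s) P Q u ↦ sub (double t s) u
  β-neg    : ∀ {e t} → negE e (negI e t) ↦ t
  β-tlam   : ∀ {e t A} → tapp e (tlam e t) A ↦ t [ A ]ᵀ
  β-open   : ∀ {e A t P s} → open′ e (pack e A t) P s ↦ (s [ A ]ᵀ) [ t ]ᵐ
  #-pair   : ∀ {Q t₁ t₂ i s} → abs Q (pair pos t₁ t₂) (inj neg i s) ↦ gabs ⊕ Q (sel i t₁ t₂) s
  #-inj    : ∀ {Q i t s₁ s₂} → abs Q (inj pos i t) (pair neg s₁ s₂) ↦ gabs ⊕ Q t (sel i s₁ s₂)
  #-lam    : ∀ {Q P t s u} → abs Q (lam pos P t) (copair neg s u) ↦ gabs ⊕ Q (t [ s ]ᵐ) u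
  #-colam  : ∀ {Q t s P u} → abs Q (copair pos t s) (lam neg P u) ↦ gabs ⊕ Q s (u [ t ]ᵐ)
  #-neg    : ∀ {Q t s} → abs Q (negI pos t) (negI neg s) ↦ gabs ⊖ Q t s
  #-tlam   : ∀ {Q t A s} → abs Q (tlam pos t) (pack neg A s) ↦ gabs ⊕ Q (t [ A ]ᵀ) s
  #-pack   : ∀ {Q A t s} → abs Q (pack pos A t) (tlam neg s) ↦ gabs ⊕ Q t (s [ A ]ᵀ)

data Hole : Set where
  ∙         : Hole
  abs₁      : MTy → Hole → Tm → Hole
  abs₂      : MTy → Tm → Hole → Hole
  wlam₁     : Sign → MTy → Hole → Hole
  wapp₁     : Sign → Hole → Tm → Hole
  wapp₂     : Sign → Tm → Hole → Hole
  pair₁     : Sign → Hole → Tm → Hole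
  pair₂     : Sign → Tm → Hole → Hole
  proj₁′    : Sign → Idx → Hole → Hole
  inj₁      : Sign → Idx → Hole → Hole
  case₁     : Sign → Hole → MTy → Tm → MTy → Tm → Hole
  case₂     : Sign → Tm → MTy → Hole → MTy → Tm → Hole
  case₃     : Sign → Tm → MTy → Tm → MTy → Hole → Hole
  lam₁      : Sign → MTy → Hole → Hole
  app₁      : Sign → Hole → Tm → Hole
  app₂      : Sign → Tm → Hole → Hole
  copair₁   : Sign → Hole → Tm → Hole
  copair₂   : Sign → Tm → Hole → Hole
  colam₁    : Sign → Hole → MTy → MTy → Tm → Hole
  colam₂    : Sign → Tm → MTy → MTy → Hole → Hole
  negI₁     : Sign → Hole → Hole
  negE₁     : Sign → Hole → Hole
  tlam₁     : Sign → Hole → Hole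
  tapp₁     : Sign → Hole → Ty → Hole
  pack₁     : Sign → Ty → Hole → Hole
  open₁     : Sign → Hole → MTy → Tm → Hole
  open₂     : Sign → Tm → MTy → Hole → Hole

plug : Hole → Tm → Tm
plug ∙ r                    = r
plug (abs₁ P C s) r         = abs P (plug C r) s
plug (abs₂ P t C) r         = abs P t (plug C r)
plug (wlam₁ e P C) r        = wlam e P (plug C r)
plug (wapp₁ e C s) r        = wapp e (plug C r) s
plug (wapp₂ e t C) r        = wapp e t (plug C r)
plug (pair₁ e C s) r        = pair e (plug C r) s
plug (pair₂ e t C) r        = pair e t (plug C r)
plug (proj₁′ e i C) r       = proj e i (plug C r)
plug (inj₁ e i C) r         = inj e i (plug C r)
plug (case₁ e C P s Q u) r  = case e (plug C r) P s Q u
plug (case₂ e t P C Q u) r  = case e t P (plug C r) Q u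
plug (case₃ e t P s Q C) r  = case e t P s Q (plug C r)
plug (lam₁ e P C) r         = lam e P (plug C r)
plug (app₁ e C s) r         = app e (plug C r) s
plug (app₂ e t C) r         = app e t (plug C r)
plug (copair₁ e C s) r      = copair e (plug C r) s
plug (copair₂ e t C) r      = copair e t (plug C r)
plug (colam₁ e C P Q s) r   = colam e (plug C r) P Q s
plug (colam₂ e t P Q C) r   = colam e t P Q (plug C r)
plug (negI₁ e C) r          = negI e (plug C r)
plug (negE₁ e C) r          = negE e (plug C r)
plug (tlam₁ e C) r          = tlam e (plug C r)
plug (tapp₁ e C A) r        = tapp e (plug C r) A
plug (pack₁ e A C) r        = pack e A (plug C r)
plug (open₁ e C P s) r      = open′ e (plug C r) P s
plug (open₂ e t P C) r      = open′ e t P (plug C r)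

infix 4 _⟶_
data _⟶_ : Tm → Tm → Set where
  step : ∀ {t s} (C : Hole) → t ↦ s → plug C t ⟶ plug C s

-- Intuitionistic terms
-- Useful = not inside the argument s of a positive weak elimination u ∘⁺ s.

NoUsefulOcc : ℕ → Tm → Set
NoUsefulOcc n (var x)            = x ≢ n
NoUsefulOcc n (abs P t s)        = NoUsefulOcc n t × NoUsefulOcc n s
NoUsefulOcc n (wlam e P t)       = NoUsefulOcc (suc n) t
NoUsefulOcc n (wapp pos t s)     = NoUsefulOcc n t
NoUsefulOcc n (wapp neg t s)     = NoUsefulOcc n t × NoUsefulOcc n s
NoUsefulOcc n (pair e t s)       = NoUsefulOcc n t × NoUsefulOcc n s
NoUsefulOcc n (proj e i t)       = NoUsefulOcc n t
NoUsefulOcc n (inj e i t)        = NoUsefulOcc n t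
NoUsefulOcc n (case e t P s Q u) = NoUsefulOcc n t × NoUsefulOcc (suc n) s × NoUsefulOcc (suc n) u
NoUsefulOcc n (lam e P t)        = NoUsefulOcc (suc n) t
NoUsefulOcc n (app e t s)        = NoUsefulOcc n t × NoUsefulOcc n s
NoUsefulOcc n (copair e t s)     = NoUsefulOcc n t × NoUsefulOcc n s
NoUsefulOcc n (colam e t P Q s)  = NoUsefulOcc n t × NoUsefulOcc (suc (suc n)) s
NoUsefulOcc n (negI e t)         = NoUsefulOcc n t
NoUsefulOcc n (negE e t)         = NoUsefulOcc n t
NoUsefulOcc n (tlam e t)         = NoUsefulOcc n t
NoUsefulOcc n (tapp e t A)       = NoUsefulOcc n t
NoUsefulOcc n (pack e A t)       = NoUsefulOcc n t
NoUsefulOcc n (open′ e t P s)    = NoUsefulOcc n t × NoUsefulOcc (suc n) s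

Intuitionistic : Tm → Set
Intuitionistic (var x)              = ⊤
Intuitionistic (abs P t s)          = Intuitionistic t × Intuitionistic s
Intuitionistic (wlam pos P r)       = Intuitionistic r × NoUsefulOcc zero r
Intuitionistic (wlam neg P r)       = Intuitionistic r
Intuitionistic (wapp pos t s)       = Intuitionistic t
Intuitionistic (wapp neg t s)       = Intuitionistic t × Intuitionistic s
Intuitionistic (pair e t s)         = Intuitionistic t × Intuitionistic s
Intuitionistic (proj e i t)         = Intuitionistic t
Intuitionistic (inj e i t)          = Intuitionistic t
Intuitionistic (case pos t P s Q u) = Intuitionistic t × Intuitionistic s × Intuitionistic u
Intuitionistic (case neg t P s Q u) = ⊥
Intuitionistic (lam e P t)          = Intuitionistic t
Intuitionistic (app e t s)          = Intuitionistic t × Intuitionistic s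
Intuitionistic (copair e t s)       = Intuitionistic t × Intuitionistic s
Intuitionistic (colam pos t P Q s)  = Intuitionistic t × Intuitionistic s
Intuitionistic (colam neg t P Q s)  = ⊥
Intuitionistic (negI e t)           = Intuitionistic t
Intuitionistic (negE pos t)         = Intuitionistic t
Intuitionistic (negE neg t)         = ⊥
Intuitionistic (tlam e t)           = Intuitionistic t
Intuitionistic (tapp e t A)         = Intuitionistic t
Intuitionistic (pack e A t)         = Intuitionistic t
Intuitionistic (open′ pos t P s)    = Intuitionistic t × Intuitionistic s
Intuitionistic (open′ neg t P s)    = ⊥

infix 4 _⊢PRJ_⦂_
_⊢PRJ_⦂_ : Ctx → Tm → MTy → Set
Γ ⊢PRJ t ⦂ P = (Γ ⊢ t ⦂ P) × Intuitionistic t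

{-# OPTIONS --safe #-}
module Submission where

-- Typing is preserved by the usual argument: weakening and substitution
-- lemmas for term variables, instantiation lemmas for type variables, and
-- the observation that the reduct of each #-redex is a generalized
-- absurdity between one premise of each side.
--
-- Being intuitionistic is preserved by reduction even for untyped terms.
-- Substituting into t keeps t intuitionistic as long as every variable
-- with a useful occurrence in t receives an intuitionistic term.  The only
-- redex that may substitute a non-intuitionistic term is (λ⁺∘ x. r) ∘⁺ s,
-- whose argument s is useless; but then condition (2) says precisely that
-- x has no useful occurrence in r.  The same fact keeps condition (2)
-- alive: a useful occurrence of a variable in r[x:=s] comes either from r
-- or from a copy of s sitting at a useful occurrence of x.

open import Defs
open import Data.Nat using (ℕ; zero; suc)
open import Data.Nat.Properties using (_≟_; suc-injective)
open import Data.List using (_∷_; map)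
open import Data.List.Properties using (map-∘; map-cong; map-id)
open import Data.Product using (_×_; _,_; proj₁; proj₂; Σ-syntax)
open import Data.Sum using (_⊎_; inj₁; inj₂; map₁; map₂)
open import Data.Unit using (tt)
open import Data.Empty using (⊥-elim)
open import Function using (_∘_)
open import Relation.Nullary using (yes; no)
open import Relation.Binary.PropositionalEquality
open ≡-Reasoning

-- Substitution of type variables

extR-∘ : ∀ {ρ ρ′ ρ″} → (∀ x → ρ (ρ′ x) ≡ ρ″ x) → ∀ x → extR ρ (extR ρ′ x) ≡ extR ρ″ x
extR-∘ h zero    = refl
extR-∘ h (suc x) = cong suc (h x)

tren-tren : ∀ {ρ ρ′ ρ″} → (∀ x → ρ (ρ′ x) ≡ ρ″ x) → ∀ A → tren ρ (tren ρ′ A) ≡ tren ρ″ A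
tren-tren h (tvar n) = cong tvar (h n)
tren-tren h (A ∧ᵗ B) = cong₂ _∧ᵗ_ (tren-tren h A) (tren-tren h B)
tren-tren h (A ∨ᵗ B) = cong₂ _∨ᵗ_ (tren-tren h A) (tren-tren h B)
tren-tren h (A ⇒ᵗ B) = cong₂ _⇒ᵗ_ (tren-tren h A) (tren-tren h B)
tren-tren h (A ⋉ᵗ B) = cong₂ _⋉ᵗ_ (tren-tren h A) (tren-tren h B)
tren-tren h (¬ᵗ A)   = cong ¬ᵗ_ (tren-tren h A)
tren-tren h (∀ᵗ A)   = cong ∀ᵗ (tren-tren (extR-∘ h) A)
tren-tren h (∃ᵗ A)   = cong ∃ᵗ (tren-tren (extR-∘ h) A)

textS-extR : ∀ {σ ρ σ′} → (∀ x → σ (ρ x) ≡ σ′ x) → ∀ x → textS σ (extR ρ x) ≡ textS σ′ x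
textS-extR h zero    = refl
textS-extR h (suc x) = cong (tren suc) (h x)

tsub-tren : ∀ {σ ρ σ′} → (∀ x → σ (ρ x) ≡ σ′ x) → ∀ A → tsub σ (tren ρ A) ≡ tsub σ′ A
tsub-tren h (tvar n) = h n
tsub-tren h (A ∧ᵗ B) = cong₂ _∧ᵗ_ (tsub-tren h A) (tsub-tren h B)
tsub-tren h (A ∨ᵗ B) = cong₂ _∨ᵗ_ (tsub-tren h A) (tsub-tren h B)
tsub-tren h (A ⇒ᵗ B) = cong₂ _⇒ᵗ_ (tsub-tren h A) (tsub-tren h B)
tsub-tren h (A ⋉ᵗ B) = cong₂ _⋉ᵗ_ (tsub-tren h A) (tsub-tren h B)
tsub-tren h (¬ᵗ A)   = cong ¬ᵗ_ (tsub-tren h A)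
tsub-tren h (∀ᵗ A)   = cong ∀ᵗ (tsub-tren (textS-extR h) A)
tsub-tren h (∃ᵗ A)   = cong ∃ᵗ (tsub-tren (textS-extR h) A)

extR-textS : ∀ {ρ σ σ′} → (∀ x → tren ρ (σ x) ≡ σ′ x) → ∀ x → tren (extR ρ) (textS σ x) ≡ textS σ′ x
extR-textS h zero = refl
extR-textS {ρ} {σ} {σ′} h (suc x) = begin
  tren (extR ρ) (tren suc (σ x)) ≡⟨ tren-tren (λ _ → refl) (σ x) ⟩
  tren (suc ∘ ρ) (σ x)           ≡⟨ tren-tren (λ _ → refl) (σ x) ⟨
  tren suc (tren ρ (σ x))        ≡⟨ cong (tren suc) (h x) ⟩
  tren suc (σ′ x)                ∎

tren-tsub : ∀ {ρ σ σ′} → (∀ x → tren ρ (σ x) ≡ σ′ x) → ∀ A → tren ρ (tsub σ A) ≡ tsub σ′ A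
tren-tsub h (tvar n) = h n
tren-tsub h (A ∧ᵗ B) = cong₂ _∧ᵗ_ (tren-tsub h A) (tren-tsub h B)
tren-tsub h (A ∨ᵗ B) = cong₂ _∨ᵗ_ (tren-tsub h A) (tren-tsub h B)
tren-tsub h (A ⇒ᵗ B) = cong₂ _⇒ᵗ_ (tren-tsub h A) (tren-tsub h B)
tren-tsub h (A ⋉ᵗ B) = cong₂ _⋉ᵗ_ (tren-tsub h A) (tren-tsub h B)
tren-tsub h (¬ᵗ A)   = cong ¬ᵗ_ (tren-tsub h A)
tren-tsub h (∀ᵗ A)   = cong ∀ᵗ (tren-tsub (extR-textS h) A)
tren-tsub h (∃ᵗ A)   = cong ∃ᵗ (tren-tsub (extR-textS h) A)

tsub-textS-tren-suc : ∀ σ A → tsub (textS σ) (tren suc A) ≡ tren suc (tsub σ A)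
tsub-textS-tren-suc σ A = trans (tsub-tren (λ _ → refl) A) (sym (tren-tsub (λ _ → refl) A))

textS-textS : ∀ {σ τ σ′} → (∀ x → tsub σ (τ x) ≡ σ′ x) → ∀ x → tsub (textS σ) (textS τ x) ≡ textS σ′ x
textS-textS h zero = refl
textS-textS {σ} {τ} {σ′} h (suc x) = begin
  tsub (textS σ) (tren suc (τ x)) ≡⟨ tsub-textS-tren-suc σ (τ x) ⟩
  tren suc (tsub σ (τ x))         ≡⟨ cong (tren suc) (h x) ⟩
  tren suc (σ′ x)                 ∎

tsub-tsub : ∀ {σ τ σ′} → (∀ x → tsub σ (τ x) ≡ σ′ x) → ∀ A → tsub σ (tsub τ A) ≡ tsub σ′ A
tsub-tsub h (tvar n) = h n
tsub-tsub h (A ∧ᵗ B) = cong₂ _∧ᵗ_ (tsub-tsub h A) (tsub-tsub h B)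
tsub-tsub h (A ∨ᵗ B) = cong₂ _∨ᵗ_ (tsub-tsub h A) (tsub-tsub h B)
tsub-tsub h (A ⇒ᵗ B) = cong₂ _⇒ᵗ_ (tsub-tsub h A) (tsub-tsub h B)
tsub-tsub h (A ⋉ᵗ B) = cong₂ _⋉ᵗ_ (tsub-tsub h A) (tsub-tsub h B)
tsub-tsub h (¬ᵗ A)   = cong ¬ᵗ_ (tsub-tsub h A)
tsub-tsub h (∀ᵗ A)   = cong ∀ᵗ (tsub-tsub (textS-textS h) A)
tsub-tsub h (∃ᵗ A)   = cong ∃ᵗ (tsub-tsub (textS-textS h) A)

textS-id : ∀ {σ} → (∀ x → σ x ≡ tvar x) → ∀ x → textS σ x ≡ tvar x
textS-id h zero    = refl
textS-id h (suc x) = cong (tren suc) (h x)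

tsub-id : ∀ {σ} → (∀ x → σ x ≡ tvar x) → ∀ A → tsub σ A ≡ A
tsub-id h (tvar n) = h n
tsub-id h (A ∧ᵗ B) = cong₂ _∧ᵗ_ (tsub-id h A) (tsub-id h B)
tsub-id h (A ∨ᵗ B) = cong₂ _∨ᵗ_ (tsub-id h A) (tsub-id h B)
tsub-id h (A ⇒ᵗ B) = cong₂ _⇒ᵗ_ (tsub-id h A) (tsub-id h B)
tsub-id h (A ⋉ᵗ B) = cong₂ _⋉ᵗ_ (tsub-id h A) (tsub-id h B)
tsub-id h (¬ᵗ A)   = cong ¬ᵗ_ (tsub-id h A)
tsub-id h (∀ᵗ A)   = cong ∀ᵗ (tsub-id (textS-id h) A)
tsub-id h (∃ᵗ A)   = cong ∃ᵗ (tsub-id (textS-id h) A)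

extR≗textS : ∀ {ρ σ} → (∀ x → tvar (ρ x) ≡ σ x) → ∀ x → tvar (extR ρ x) ≡ textS σ x
extR≗textS h zero    = refl
extR≗textS h (suc x) = cong (tren suc) (h x)

tren≗tsub : ∀ {ρ σ} → (∀ x → tvar (ρ x) ≡ σ x) → ∀ A → tren ρ A ≡ tsub σ A
tren≗tsub h (tvar n) = h n
tren≗tsub h (A ∧ᵗ B) = cong₂ _∧ᵗ_ (tren≗tsub h A) (tren≗tsub h B)
tren≗tsub h (A ∨ᵗ B) = cong₂ _∨ᵗ_ (tren≗tsub h A) (tren≗tsub h B)
tren≗tsub h (A ⇒ᵗ B) = cong₂ _⇒ᵗ_ (tren≗tsub h A) (tren≗tsub h B)
tren≗tsub h (A ⋉ᵗ B) = cong₂ _⋉ᵗ_ (tren≗tsub h A) (tren≗tsub h B)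
tren≗tsub h (¬ᵗ A)   = cong ¬ᵗ_ (tren≗tsub h A)
tren≗tsub h (∀ᵗ A)   = cong ∀ᵗ (tren≗tsub (extR≗textS h) A)
tren≗tsub h (∃ᵗ A)   = cong ∃ᵗ (tren≗tsub (extR≗textS h) A)

tren-suc-[]ᵗ : ∀ B A → tren suc A [ B ]ᵗ ≡ A
tren-suc-[]ᵗ B A = trans (tsub-tren (λ _ → refl) A) (tsub-id (λ _ → refl) A)

tsub-[]ᵗ : ∀ σ A B → tsub σ (B [ A ]ᵗ) ≡ tsub (textS σ) B [ tsub σ A ]ᵗ
tsub-[]ᵗ σ A B = trans (tsub-tsub (λ _ → refl) B) (sym (tsub-tsub tsingle-textS B))
  where
  tsingle-textS : ∀ x → tsub (tsingle (tsub σ A)) (textS σ x) ≡ tsub σ (tsingle A x)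
  tsingle-textS zero    = refl
  tsingle-textS (suc x) = tren-suc-[]ᵗ (tsub σ A) (σ x)

msub-textS-mshift : ∀ σ P → msub (textS σ) (mshift P) ≡ mshift (msub σ P)
msub-textS-mshift σ (A ^ m) = cong (_^ m) (tsub-textS-tren-suc σ A)

msub-tsingle-mshift : ∀ A P → msub (tsingle A) (mshift P) ≡ P
msub-tsingle-mshift A (B ^ m) = cong (_^ m) (tren-suc-[]ᵗ A B)

mren≗msub : ∀ {ρ σ} → (∀ x → tvar (ρ x) ≡ σ x) → ∀ P → mren ρ P ≡ msub σ P
mren≗msub h (A ^ m) = cong (_^ m) (tren≗tsub h A)

map-msub-textS-shiftCtx : ∀ σ Γ → map (msub (textS σ)) (shiftCtx Γ) ≡ shiftCtx (map (msub σ) Γ)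
map-msub-textS-shiftCtx σ Γ =
  trans (sym (map-∘ Γ)) (trans (map-cong (msub-textS-mshift σ) Γ) (map-∘ Γ))

map-msub-tsingle-shiftCtx : ∀ A Γ → map (msub (tsingle A)) (shiftCtx Γ) ≡ Γ
map-msub-tsingle-shiftCtx A Γ =
  trans (sym (map-∘ Γ)) (trans (map-cong (msub-tsingle-mshift A) Γ) (map-id Γ))

private
  cong₃ : ∀ {A B C D : Set} (f : A → B → C → D) {a a′ b b′ c c′} →
          a ≡ a′ → b ≡ b′ → c ≡ c′ → f a b c ≡ f a′ b′ c′
  cong₃ f refl refl refl = refl

  cong₄ : ∀ {A B C D E : Set} (f : A → B → C → D → E) {a a′ b b′ c c′ d d′} →
          a ≡ a′ → b ≡ b′ → c ≡ c′ → d ≡ d′ → f a b c d ≡ f a′ b′ c′ d′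
  cong₄ f refl refl refl refl = refl

  cong₅ : ∀ {A B C D E F : Set} (f : A → B → C → D → E → F) {a a′ b b′ c c′ d d′ e e′} →
          a ≡ a′ → b ≡ b′ → c ≡ c′ → d ≡ d′ → e ≡ e′ → f a b c d e ≡ f a′ b′ c′ d′ e′
  cong₅ f refl refl refl refl refl = refl

tyRen≗tySub : ∀ {ρ σ} → (∀ x → tvar (ρ x) ≡ σ x) → ∀ t → tyRen ρ t ≡ tySub σ t
tyRen≗tySub h (var x)            = refl
tyRen≗tySub h (abs P t s)        = cong₃ abs (mren≗msub h P) (tyRen≗tySub h t) (tyRen≗tySub h s)
tyRen≗tySub h (wlam e P t)       = cong₂ (wlam e) (mren≗msub h P) (tyRen≗tySub h t)
tyRen≗tySub h (wapp e t s)       = cong₂ (wapp e) (tyRen≗tySub h t) (tyRen≗tySub h s)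
tyRen≗tySub h (pair e t s)       = cong₂ (pair e) (tyRen≗tySub h t) (tyRen≗tySub h s)
tyRen≗tySub h (proj e i t)       = cong (proj e i) (tyRen≗tySub h t)
tyRen≗tySub h (inj e i t)        = cong (inj e i) (tyRen≗tySub h t)
tyRen≗tySub h (case e t P s Q u) =
  cong₅ (case e) (tyRen≗tySub h t) (mren≗msub h P) (tyRen≗tySub h s) (mren≗msub h Q) (tyRen≗tySub h u)
tyRen≗tySub h (lam e P t)        = cong₂ (lam e) (mren≗msub h P) (tyRen≗tySub h t)
tyRen≗tySub h (app e t s)        = cong₂ (app e) (tyRen≗tySub h t) (tyRen≗tySub h s)
tyRen≗tySub h (copair e t s)     = cong₂ (copair e) (tyRen≗tySub h t) (tyRen≗tySub h s)
tyRen≗tySub h (colam e t P Q s)  =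
  cong₄ (colam e) (tyRen≗tySub h t) (mren≗msub h P) (mren≗msub h Q) (tyRen≗tySub h s)
tyRen≗tySub h (negI e t)         = cong (negI e) (tyRen≗tySub h t)
tyRen≗tySub h (negE e t)         = cong (negE e) (tyRen≗tySub h t)
tyRen≗tySub h (tlam e t)         = cong (tlam e) (tyRen≗tySub (extR≗textS h) t)
tyRen≗tySub h (tapp e t A)       = cong₂ (tapp e) (tyRen≗tySub h t) (tren≗tsub h A)
tyRen≗tySub h (pack e A t)       = cong₂ (pack e) (tren≗tsub h A) (tyRen≗tySub h t)
tyRen≗tySub h (open′ e t P s)    =
  cong₃ (open′ e) (tyRen≗tySub h t) (mren≗msub (extR≗textS h) P) (tyRen≗tySub (extR≗textS h) s)

-- Typing under substitution

∋-map : ∀ {f : MTy → MTy} {Γ x P} → Γ ∋ x ⦂ P → map f Γ ∋ x ⦂ f P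
∋-map here      = here
∋-map (there x) = there (∋-map x)

∋-map⁻ : ∀ {f : MTy → MTy} {Γ x Q} → map f Γ ∋ x ⦂ Q → Σ[ P ∈ MTy ] (Γ ∋ x ⦂ P) × (f P ≡ Q)
∋-map⁻ {Γ = P ∷ Γ} here = P , here , refl
∋-map⁻ {Γ = P ∷ Γ} (there x) with ∋-map⁻ x
... | R , y , eq = R , there y , eq

⊢-tySub : ∀ {Γ t P} (σ : ℕ → Ty) → Γ ⊢ t ⦂ P → map (msub σ) Γ ⊢ tySub σ t ⦂ msub σ P
⊢-tySub σ (ax x)        = ax (∋-map x)
⊢-tySub σ (absurd d e)  = absurd (⊢-tySub σ d) (⊢-tySub σ e)
⊢-tySub σ (wlam⁺ d)     = wlam⁺ (⊢-tySub σ d)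
⊢-tySub σ (wlam⁻ d)     = wlam⁻ (⊢-tySub σ d)
⊢-tySub σ (wapp⁺ d e)   = wapp⁺ (⊢-tySub σ d) (⊢-tySub σ e)
⊢-tySub σ (wapp⁻ d e)   = wapp⁻ (⊢-tySub σ d) (⊢-tySub σ e)
⊢-tySub σ (pair⁺ d e)   = pair⁺ (⊢-tySub σ d) (⊢-tySub σ e)
⊢-tySub σ (pair⁻ d e)   = pair⁻ (⊢-tySub σ d) (⊢-tySub σ e)
⊢-tySub σ (proj⁺ i₁ d)  = proj⁺ i₁ (⊢-tySub σ d)
⊢-tySub σ (proj⁺ i₂ d)  = proj⁺ i₂ (⊢-tySub σ d)
⊢-tySub σ (proj⁻ i₁ d)  = proj⁻ i₁ (⊢-tySub σ d)
⊢-tySub σ (proj⁻ i₂ d)  = proj⁻ i₂ (⊢-tySub σ d)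
⊢-tySub σ (inj⁺ i₁ d)   = inj⁺ i₁ (⊢-tySub σ d)
⊢-tySub σ (inj⁺ i₂ d)   = inj⁺ i₂ (⊢-tySub σ d)
⊢-tySub σ (inj⁻ i₁ d)   = inj⁻ i₁ (⊢-tySub σ d)
⊢-tySub σ (inj⁻ i₂ d)   = inj⁻ i₂ (⊢-tySub σ d)
⊢-tySub σ (case⁺ d e f) = case⁺ (⊢-tySub σ d) (⊢-tySub σ e) (⊢-tySub σ f)
⊢-tySub σ (case⁻ d e f) = case⁻ (⊢-tySub σ d) (⊢-tySub σ e) (⊢-tySub σ f)
⊢-tySub σ (lam⁺ d)      = lam⁺ (⊢-tySub σ d)
⊢-tySub σ (lam⁻ d)      = lam⁻ (⊢-tySub σ d)
⊢-tySub σ (app⁺ d e)    = app⁺ (⊢-tySub σ d) (⊢-tySub σ e)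
⊢-tySub σ (app⁻ d e)    = app⁻ (⊢-tySub σ d) (⊢-tySub σ e)
⊢-tySub σ (copair⁺ d e) = copair⁺ (⊢-tySub σ d) (⊢-tySub σ e)
⊢-tySub σ (copair⁻ d e) = copair⁻ (⊢-tySub σ d) (⊢-tySub σ e)
⊢-tySub σ (colam⁺ d e)  = colam⁺ (⊢-tySub σ d) (⊢-tySub σ e)
⊢-tySub σ (colam⁻ d e)  = colam⁻ (⊢-tySub σ d) (⊢-tySub σ e)
⊢-tySub σ (negI⁺ d)     = negI⁺ (⊢-tySub σ d)
⊢-tySub σ (negI⁻ d)     = negI⁻ (⊢-tySub σ d)
⊢-tySub σ (negE⁺ d)     = negE⁺ (⊢-tySub σ d)
⊢-tySub σ (negE⁻ d)     = negE⁻ (⊢-tySub σ d)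
⊢-tySub σ (tlam⁺ {Γ} d) =
  tlam⁺ (subst (_⊢ _ ⦂ _) (map-msub-textS-shiftCtx σ Γ) (⊢-tySub (textS σ) d))
⊢-tySub σ (tlam⁻ {Γ} d) =
  tlam⁻ (subst (_⊢ _ ⦂ _) (map-msub-textS-shiftCtx σ Γ) (⊢-tySub (textS σ) d))
⊢-tySub σ (tapp⁺ {B = B} A d) =
  subst (λ C → _ ⊢ _ ⦂ C ^ ⊕) (sym (tsub-[]ᵗ σ A B)) (tapp⁺ (tsub σ A) (⊢-tySub σ d))
⊢-tySub σ (tapp⁻ {B = B} A d) =
  subst (λ C → _ ⊢ _ ⦂ C ^ ⊖) (sym (tsub-[]ᵗ σ A B)) (tapp⁻ (tsub σ A) (⊢-tySub σ d))
⊢-tySub σ (pack⁺ {B = B} A d) =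
  pack⁺ (tsub σ A) (subst (λ C → _ ⊢ _ ⦂ C ^ ⊕) (tsub-[]ᵗ σ A B) (⊢-tySub σ d))
⊢-tySub σ (pack⁻ {B = B} A d) =
  pack⁻ (tsub σ A) (subst (λ C → _ ⊢ _ ⦂ C ^ ⊖) (tsub-[]ᵗ σ A B) (⊢-tySub σ d))
⊢-tySub σ (open⁺ {Γ} {P = P} d e) = open⁺ (⊢-tySub σ d)
  (subst₂ (λ Δ R → (_ ∷ Δ) ⊢ _ ⦂ R) (map-msub-textS-shiftCtx σ Γ) (msub-textS-mshift σ P)
    (⊢-tySub (textS σ) e))
⊢-tySub σ (open⁻ {Γ} {P = P} d e) = open⁻ (⊢-tySub σ d)
  (subst₂ (λ Δ R → (_ ∷ Δ) ⊢ _ ⦂ R) (map-msub-textS-shiftCtx σ Γ) (msub-textS-mshift σ P)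
    (⊢-tySub (textS σ) e))

⊢-tyRen-suc : ∀ {Γ t P} → Γ ⊢ t ⦂ P → shiftCtx Γ ⊢ tyRen suc t ⦂ mshift P
⊢-tyRen-suc {Γ} {t} {P} d =
  subst₃ (map-cong (mren≗msub (λ _ → refl)) Γ) (tyRen≗tySub (λ _ → refl) t) (mren≗msub (λ _ → refl) P)
    (⊢-tySub (tvar ∘ suc) d)
  where
  subst₃ : ∀ {Δ Δ′ u u′ Q Q′} → Δ′ ≡ Δ → u′ ≡ u → Q′ ≡ Q → Δ ⊢ u ⦂ Q → Δ′ ⊢ u′ ⦂ Q′
  subst₃ refl refl refl d = d

⊢-[]ᵀ : ∀ {Γ t B m} A → shiftCtx Γ ⊢ t ⦂ B ^ m → Γ ⊢ t [ A ]ᵀ ⦂ B [ A ]ᵗ ^ m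
⊢-[]ᵀ {Γ} A d = subst (_⊢ _ ⦂ _) (map-msub-tsingle-shiftCtx A Γ) (⊢-tySub (tsingle A) d)

⊢-open-[]ᵀ : ∀ {Γ s P Q} A → (Q ∷ shiftCtx Γ) ⊢ s ⦂ mshift P → (msub (tsingle A) Q ∷ Γ) ⊢ s [ A ]ᵀ ⦂ P
⊢-open-[]ᵀ {Γ} {P = P} A d =
  subst₂ (λ Δ R → (_ ∷ Δ) ⊢ _ ⦂ R) (map-msub-tsingle-shiftCtx A Γ) (msub-tsingle-mshift A P)
    (⊢-tySub (tsingle A) d)

Ren : Ctx → Ctx → (ℕ → ℕ) → Set
Ren Γ Δ ρ = ∀ {x P} → Γ ∋ x ⦂ P → Δ ∋ ρ x ⦂ P

Ren-extR : ∀ {Γ Δ ρ Q} → Ren Γ Δ ρ → Ren (Q ∷ Γ) (Q ∷ Δ) (extR ρ)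
Ren-extR h here      = here
Ren-extR h (there x) = there (h x)

Ren-shiftCtx : ∀ {Γ Δ ρ} → Ren Γ Δ ρ → Ren (shiftCtx Γ) (shiftCtx Δ) ρ
Ren-shiftCtx h x with ∋-map⁻ x
... | P , y , refl = ∋-map (h y)

⊢-ren : ∀ {Γ Δ ρ t P} → Ren Γ Δ ρ → Γ ⊢ t ⦂ P → Δ ⊢ ren ρ t ⦂ P
⊢-ren h (ax x)        = ax (h x)
⊢-ren h (absurd d e)  = absurd (⊢-ren h d) (⊢-ren h e)
⊢-ren h (wlam⁺ d)     = wlam⁺ (⊢-ren (Ren-extR h) d)
⊢-ren h (wlam⁻ d)     = wlam⁻ (⊢-ren (Ren-extR h) d)
⊢-ren h (wapp⁺ d e)   = wapp⁺ (⊢-ren h d) (⊢-ren h e)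
⊢-ren h (wapp⁻ d e)   = wapp⁻ (⊢-ren h d) (⊢-ren h e)
⊢-ren h (pair⁺ d e)   = pair⁺ (⊢-ren h d) (⊢-ren h e)
⊢-ren h (pair⁻ d e)   = pair⁻ (⊢-ren h d) (⊢-ren h e)
⊢-ren h (proj⁺ i d)   = proj⁺ i (⊢-ren h d)
⊢-ren h (proj⁻ i d)   = proj⁻ i (⊢-ren h d)
⊢-ren h (inj⁺ i d)    = inj⁺ i (⊢-ren h d)
⊢-ren h (inj⁻ i d)    = inj⁻ i (⊢-ren h d)
⊢-ren h (case⁺ d e f) = case⁺ (⊢-ren h d) (⊢-ren (Ren-extR h) e) (⊢-ren (Ren-extR h) f)
⊢-ren h (case⁻ d e f) = case⁻ (⊢-ren h d) (⊢-ren (Ren-extR h) e) (⊢-ren (Ren-extR h) f)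
⊢-ren h (lam⁺ d)      = lam⁺ (⊢-ren (Ren-extR h) d)
⊢-ren h (lam⁻ d)      = lam⁻ (⊢-ren (Ren-extR h) d)
⊢-ren h (app⁺ d e)    = app⁺ (⊢-ren h d) (⊢-ren h e)
⊢-ren h (app⁻ d e)    = app⁻ (⊢-ren h d) (⊢-ren h e)
⊢-ren h (copair⁺ d e) = copair⁺ (⊢-ren h d) (⊢-ren h e)
⊢-ren h (copair⁻ d e) = copair⁻ (⊢-ren h d) (⊢-ren h e)
⊢-ren h (colam⁺ d e)  = colam⁺ (⊢-ren h d) (⊢-ren (Ren-extR (Ren-extR h)) e)
⊢-ren h (colam⁻ d e)  = colam⁻ (⊢-ren h d) (⊢-ren (Ren-extR (Ren-extR h)) e)
⊢-ren h (negI⁺ d)     = negI⁺ (⊢-ren h d)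
⊢-ren h (negI⁻ d)     = negI⁻ (⊢-ren h d)
⊢-ren h (negE⁺ d)     = negE⁺ (⊢-ren h d)
⊢-ren h (negE⁻ d)     = negE⁻ (⊢-ren h d)
⊢-ren h (tlam⁺ d)     = tlam⁺ (⊢-ren (Ren-shiftCtx h) d)
⊢-ren h (tlam⁻ d)     = tlam⁻ (⊢-ren (Ren-shiftCtx h) d)
⊢-ren h (tapp⁺ A d)   = tapp⁺ A (⊢-ren h d)
⊢-ren h (tapp⁻ A d)   = tapp⁻ A (⊢-ren h d)
⊢-ren h (pack⁺ A d)   = pack⁺ A (⊢-ren h d)
⊢-ren h (pack⁻ A d)   = pack⁻ A (⊢-ren h d)
⊢-ren h (open⁺ d e)   = open⁺ (⊢-ren h d) (⊢-ren (Ren-extR (Ren-shiftCtx h)) e)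
⊢-ren h (open⁻ d e)   = open⁻ (⊢-ren h d) (⊢-ren (Ren-extR (Ren-shiftCtx h)) e)

Sub : Ctx → Ctx → (ℕ → Tm) → Set
Sub Γ Δ σ = ∀ {x P} → Γ ∋ x ⦂ P → Δ ⊢ σ x ⦂ P

Sub-extS : ∀ {Γ Δ σ Q} → Sub Γ Δ σ → Sub (Q ∷ Γ) (Q ∷ Δ) (extS σ)
Sub-extS h here      = ax here
Sub-extS h (there x) = ⊢-ren there (h x)

Sub-tyExtS : ∀ {Γ Δ σ} → Sub Γ Δ σ → Sub (shiftCtx Γ) (shiftCtx Δ) (tyExtS σ)
Sub-tyExtS h x with ∋-map⁻ x
... | P , y , refl = ⊢-tyRen-suc (h y)

Sub-single : ∀ {Γ s Q} → Γ ⊢ s ⦂ Q → Sub (Q ∷ Γ) Γ (single s)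
Sub-single d here      = d
Sub-single d (there x) = ax x

Sub-double : ∀ {Γ t s Q R} → Γ ⊢ t ⦂ Q → Γ ⊢ s ⦂ R → Sub (R ∷ Q ∷ Γ) Γ (double t s)
Sub-double d e here              = e
Sub-double d e (there here)      = d
Sub-double d e (there (there x)) = ax x

⊢-sub : ∀ {Γ Δ σ t P} → Sub Γ Δ σ → Γ ⊢ t ⦂ P → Δ ⊢ sub σ t ⦂ P
⊢-sub h (ax x)        = h x
⊢-sub h (absurd d e)  = absurd (⊢-sub h d) (⊢-sub h e)
⊢-sub h (wlam⁺ d)     = wlam⁺ (⊢-sub (Sub-extS h) d)
⊢-sub h (wlam⁻ d)     = wlam⁻ (⊢-sub (Sub-extS h) d)
⊢-sub h (wapp⁺ d e)   = wapp⁺ (⊢-sub h d) (⊢-sub h e)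
⊢-sub h (wapp⁻ d e)   = wapp⁻ (⊢-sub h d) (⊢-sub h e)
⊢-sub h (pair⁺ d e)   = pair⁺ (⊢-sub h d) (⊢-sub h e)
⊢-sub h (pair⁻ d e)   = pair⁻ (⊢-sub h d) (⊢-sub h e)
⊢-sub h (proj⁺ i d)   = proj⁺ i (⊢-sub h d)
⊢-sub h (proj⁻ i d)   = proj⁻ i (⊢-sub h d)
⊢-sub h (inj⁺ i d)    = inj⁺ i (⊢-sub h d)
⊢-sub h (inj⁻ i d)    = inj⁻ i (⊢-sub h d)
⊢-sub h (case⁺ d e f) = case⁺ (⊢-sub h d) (⊢-sub (Sub-extS h) e) (⊢-sub (Sub-extS h) f)
⊢-sub h (case⁻ d e f) = case⁻ (⊢-sub h d) (⊢-sub (Sub-extS h) e) (⊢-sub (Sub-extS h) f)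
⊢-sub h (lam⁺ d)      = lam⁺ (⊢-sub (Sub-extS h) d)
⊢-sub h (lam⁻ d)      = lam⁻ (⊢-sub (Sub-extS h) d)
⊢-sub h (app⁺ d e)    = app⁺ (⊢-sub h d) (⊢-sub h e)
⊢-sub h (app⁻ d e)    = app⁻ (⊢-sub h d) (⊢-sub h e)
⊢-sub h (copair⁺ d e) = copair⁺ (⊢-sub h d) (⊢-sub h e)
⊢-sub h (copair⁻ d e) = copair⁻ (⊢-sub h d) (⊢-sub h e)
⊢-sub h (colam⁺ d e)  = colam⁺ (⊢-sub h d) (⊢-sub (Sub-extS (Sub-extS h)) e)
⊢-sub h (colam⁻ d e)  = colam⁻ (⊢-sub h d) (⊢-sub (Sub-extS (Sub-extS h)) e)
⊢-sub h (negI⁺ d)     = negI⁺ (⊢-sub h d)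
⊢-sub h (negI⁻ d)     = negI⁻ (⊢-sub h d)
⊢-sub h (negE⁺ d)     = negE⁺ (⊢-sub h d)
⊢-sub h (negE⁻ d)     = negE⁻ (⊢-sub h d)
⊢-sub h (tlam⁺ d)     = tlam⁺ (⊢-sub (Sub-tyExtS h) d)
⊢-sub h (tlam⁻ d)     = tlam⁻ (⊢-sub (Sub-tyExtS h) d)
⊢-sub h (tapp⁺ A d)   = tapp⁺ A (⊢-sub h d)
⊢-sub h (tapp⁻ A d)   = tapp⁻ A (⊢-sub h d)
⊢-sub h (pack⁺ A d)   = pack⁺ A (⊢-sub h d)
⊢-sub h (pack⁻ A d)   = pack⁻ A (⊢-sub h d)
⊢-sub h (open⁺ d e)   = open⁺ (⊢-sub h d) (⊢-sub (Sub-extS (Sub-tyExtS h)) e)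
⊢-sub h (open⁻ d e)   = open⁻ (⊢-sub h d) (⊢-sub (Sub-extS (Sub-tyExtS h)) e)

⊢-[]ᵐ : ∀ {Γ t s P Q} → (Q ∷ Γ) ⊢ t ⦂ P → Γ ⊢ s ⦂ Q → Γ ⊢ t [ s ]ᵐ ⦂ P
⊢-[]ᵐ d e = ⊢-sub (Sub-single e) d

-- Subject reduction for λ^PRK

⊢-gabs⊕ : ∀ {Γ t s A Q} → Γ ⊢ t ⦂ A ^ ⊕ → Γ ⊢ s ⦂ A ^ ⊖ → Γ ⊢ gabs ⊕ Q t s ⦂ Q
⊢-gabs⊕ d e = absurd (wapp⁺ d e) (wapp⁻ e d)

⊢-gabs⊖ : ∀ {Γ t s A Q} → Γ ⊢ t ⦂ A ^ ⊖ → Γ ⊢ s ⦂ A ^ ⊕ → Γ ⊢ gabs ⊖ Q t s ⦂ Q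
⊢-gabs⊖ d e = absurd (wapp⁺ e d) (wapp⁻ d e)

↦-preserves-⊢ : ∀ {Γ t s P} → t ↦ s → Γ ⊢ t ⦂ P → Γ ⊢ s ⦂ P
↦-preserves-⊢ β-weak  (wapp⁺ (wlam⁺ d) e)              = ⊢-[]ᵐ d e
↦-preserves-⊢ β-weak  (wapp⁻ (wlam⁻ d) e)              = ⊢-[]ᵐ d e
↦-preserves-⊢ β-pair  (proj⁺ i₁ (pair⁺ d e))           = d
↦-preserves-⊢ β-pair  (proj⁺ i₂ (pair⁺ d e))           = e
↦-preserves-⊢ β-pair  (proj⁻ i₁ (pair⁻ d e))           = d
↦-preserves-⊢ β-pair  (proj⁻ i₂ (pair⁻ d e))           = e
↦-preserves-⊢ β-case  (case⁺ (inj⁺ i₁ d) e f)          = ⊢-[]ᵐ e d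
↦-preserves-⊢ β-case  (case⁺ (inj⁺ i₂ d) e f)          = ⊢-[]ᵐ f d
↦-preserves-⊢ β-case  (case⁻ (inj⁻ i₁ d) e f)          = ⊢-[]ᵐ e d
↦-preserves-⊢ β-case  (case⁻ (inj⁻ i₂ d) e f)          = ⊢-[]ᵐ f d
↦-preserves-⊢ β-lam   (app⁺ (lam⁺ d) e)                = ⊢-[]ᵐ d e
↦-preserves-⊢ β-lam   (app⁻ (lam⁻ d) e)                = ⊢-[]ᵐ d e
↦-preserves-⊢ β-colam (colam⁺ (copair⁺ d e) f)         = ⊢-sub (Sub-double d e) f
↦-preserves-⊢ β-colam (colam⁻ (copair⁻ d e) f)         = ⊢-sub (Sub-double d e) f
↦-preserves-⊢ β-neg   (negE⁺ (negI⁺ d))                = d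
↦-preserves-⊢ β-neg   (negE⁻ (negI⁻ d))                = d
↦-preserves-⊢ β-tlam  (tapp⁺ A (tlam⁺ d))              = ⊢-[]ᵀ A d
↦-preserves-⊢ β-tlam  (tapp⁻ A (tlam⁻ d))              = ⊢-[]ᵀ A d
↦-preserves-⊢ β-open  (open⁺ (pack⁺ A d) e)            = ⊢-[]ᵐ (⊢-open-[]ᵀ A e) d
↦-preserves-⊢ β-open  (open⁻ (pack⁻ A d) e)            = ⊢-[]ᵐ (⊢-open-[]ᵀ A e) d
↦-preserves-⊢ #-pair  (absurd (pair⁺ d e) (inj⁻ i₁ f)) = ⊢-gabs⊕ d f
↦-preserves-⊢ #-pair  (absurd (pair⁺ d e) (inj⁻ i₂ f)) = ⊢-gabs⊕ e f
↦-preserves-⊢ #-inj   (absurd (inj⁺ i₁ d) (pair⁻ e f)) = ⊢-gabs⊕ d e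
↦-preserves-⊢ #-inj   (absurd (inj⁺ i₂ d) (pair⁻ e f)) = ⊢-gabs⊕ d f
↦-preserves-⊢ #-lam   (absurd (lam⁺ d) (copair⁻ e f))  = ⊢-gabs⊕ (⊢-[]ᵐ d e) f
↦-preserves-⊢ #-colam (absurd (copair⁺ d e) (lam⁻ f))  = ⊢-gabs⊕ e (⊢-[]ᵐ f d)
↦-preserves-⊢ #-neg   (absurd (negI⁺ d) (negI⁻ e))     = ⊢-gabs⊖ d e
↦-preserves-⊢ #-tlam  (absurd (tlam⁺ d) (pack⁻ A e))   = ⊢-gabs⊕ (⊢-[]ᵀ A d) e
↦-preserves-⊢ #-pack  (absurd (pack⁺ A d) (tlam⁻ e))   = ⊢-gabs⊕ d (⊢-[]ᵀ A e)

module _ {t s : Tm} (preserves : ∀ {Γ P} → Γ ⊢ t ⦂ P → Γ ⊢ s ⦂ P) where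

  ⊢-plug : ∀ C {Γ P} → Γ ⊢ plug C t ⦂ P → Γ ⊢ plug C s ⦂ P
  ⊢-plug ∙                   d               = preserves d
  ⊢-plug (abs₁ _ C _)        (absurd d e)    = absurd (⊢-plug C d) e
  ⊢-plug (abs₂ _ _ C)        (absurd d e)    = absurd d (⊢-plug C e)
  ⊢-plug (wlam₁ _ _ C)       (wlam⁺ d)       = wlam⁺ (⊢-plug C d)
  ⊢-plug (wlam₁ _ _ C)       (wlam⁻ d)       = wlam⁻ (⊢-plug C d)
  ⊢-plug (wapp₁ _ C _)       (wapp⁺ d e)     = wapp⁺ (⊢-plug C d) e
  ⊢-plug (wapp₁ _ C _)       (wapp⁻ d e)     = wapp⁻ (⊢-plug C d) e
  ⊢-plug (wapp₂ _ _ C)       (wapp⁺ d e)     = wapp⁺ d (⊢-plug C e)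
  ⊢-plug (wapp₂ _ _ C)       (wapp⁻ d e)     = wapp⁻ d (⊢-plug C e)
  ⊢-plug (pair₁ _ C _)       (pair⁺ d e)     = pair⁺ (⊢-plug C d) e
  ⊢-plug (pair₁ _ C _)       (pair⁻ d e)     = pair⁻ (⊢-plug C d) e
  ⊢-plug (pair₂ _ _ C)       (pair⁺ d e)     = pair⁺ d (⊢-plug C e)
  ⊢-plug (pair₂ _ _ C)       (pair⁻ d e)     = pair⁻ d (⊢-plug C e)
  ⊢-plug (proj₁′ _ _ C)      (proj⁺ i d)     = proj⁺ i (⊢-plug C d)
  ⊢-plug (proj₁′ _ _ C)      (proj⁻ i d)     = proj⁻ i (⊢-plug C d)
  ⊢-plug (inj₁ _ _ C)        (inj⁺ i d)      = inj⁺ i (⊢-plug C d)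
  ⊢-plug (inj₁ _ _ C)        (inj⁻ i d)      = inj⁻ i (⊢-plug C d)
  ⊢-plug (case₁ _ C _ _ _ _) (case⁺ d e f)   = case⁺ (⊢-plug C d) e f
  ⊢-plug (case₁ _ C _ _ _ _) (case⁻ d e f)   = case⁻ (⊢-plug C d) e f
  ⊢-plug (case₂ _ _ _ C _ _) (case⁺ d e f)   = case⁺ d (⊢-plug C e) f
  ⊢-plug (case₂ _ _ _ C _ _) (case⁻ d e f)   = case⁻ d (⊢-plug C e) f
  ⊢-plug (case₃ _ _ _ _ _ C) (case⁺ d e f)   = case⁺ d e (⊢-plug C f)
  ⊢-plug (case₃ _ _ _ _ _ C) (case⁻ d e f)   = case⁻ d e (⊢-plug C f)
  ⊢-plug (lam₁ _ _ C)        (lam⁺ d)        = lam⁺ (⊢-plug C d)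
  ⊢-plug (lam₁ _ _ C)        (lam⁻ d)        = lam⁻ (⊢-plug C d)
  ⊢-plug (app₁ _ C _)        (app⁺ d e)      = app⁺ (⊢-plug C d) e
  ⊢-plug (app₁ _ C _)        (app⁻ d e)      = app⁻ (⊢-plug C d) e
  ⊢-plug (app₂ _ _ C)        (app⁺ d e)      = app⁺ d (⊢-plug C e)
  ⊢-plug (app₂ _ _ C)        (app⁻ d e)      = app⁻ d (⊢-plug C e)
  ⊢-plug (copair₁ _ C _)     (copair⁺ d e)   = copair⁺ (⊢-plug C d) e
  ⊢-plug (copair₁ _ C _)     (copair⁻ d e)   = copair⁻ (⊢-plug C d) e
  ⊢-plug (copair₂ _ _ C)     (copair⁺ d e)   = copair⁺ d (⊢-plug C e)
  ⊢-plug (copair₂ _ _ C)     (copair⁻ d e)   = copair⁻ d (⊢-plug C e)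
  ⊢-plug (colam₁ _ C _ _ _)  (colam⁺ d e)    = colam⁺ (⊢-plug C d) e
  ⊢-plug (colam₁ _ C _ _ _)  (colam⁻ d e)    = colam⁻ (⊢-plug C d) e
  ⊢-plug (colam₂ _ _ _ _ C)  (colam⁺ d e)    = colam⁺ d (⊢-plug C e)
  ⊢-plug (colam₂ _ _ _ _ C)  (colam⁻ d e)    = colam⁻ d (⊢-plug C e)
  ⊢-plug (negI₁ _ C)         (negI⁺ d)       = negI⁺ (⊢-plug C d)
  ⊢-plug (negI₁ _ C)         (negI⁻ d)       = negI⁻ (⊢-plug C d)
  ⊢-plug (negE₁ _ C)         (negE⁺ d)       = negE⁺ (⊢-plug C d)
  ⊢-plug (negE₁ _ C)         (negE⁻ d)       = negE⁻ (⊢-plug C d)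
  ⊢-plug (tlam₁ _ C)         (tlam⁺ d)       = tlam⁺ (⊢-plug C d)
  ⊢-plug (tlam₁ _ C)         (tlam⁻ d)       = tlam⁻ (⊢-plug C d)
  ⊢-plug (tapp₁ _ C _)       (tapp⁺ A d)     = tapp⁺ A (⊢-plug C d)
  ⊢-plug (tapp₁ _ C _)       (tapp⁻ A d)     = tapp⁻ A (⊢-plug C d)
  ⊢-plug (pack₁ _ _ C)       (pack⁺ A d)     = pack⁺ A (⊢-plug C d)
  ⊢-plug (pack₁ _ _ C)       (pack⁻ A d)     = pack⁻ A (⊢-plug C d)
  ⊢-plug (open₁ _ C _ _)     (open⁺ d e)     = open⁺ (⊢-plug C d) e
  ⊢-plug (open₁ _ C _ _)     (open⁻ d e)     = open⁻ (⊢-plug C d) e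
  ⊢-plug (open₂ _ _ _ C)     (open⁺ d e)     = open⁺ d (⊢-plug C e)
  ⊢-plug (open₂ _ _ _ C)     (open⁻ d e)     = open⁻ d (⊢-plug C e)

-- Substitution into intuitionistic terms

NoUsefulOcc-tySub : ∀ σ {n} t → NoUsefulOcc n t → NoUsefulOcc n (tySub σ t)
NoUsefulOcc-tySub σ (var x)            h           = h
NoUsefulOcc-tySub σ (abs P t s)        (a , b)     = NoUsefulOcc-tySub σ t a , NoUsefulOcc-tySub σ s b
NoUsefulOcc-tySub σ (wlam e P t)       h           = NoUsefulOcc-tySub σ t h
NoUsefulOcc-tySub σ (wapp pos t s)     h           = NoUsefulOcc-tySub σ t h
NoUsefulOcc-tySub σ (wapp neg t s)     (a , b)     = NoUsefulOcc-tySub σ t a , NoUsefulOcc-tySub σ s b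
NoUsefulOcc-tySub σ (pair e t s)       (a , b)     = NoUsefulOcc-tySub σ t a , NoUsefulOcc-tySub σ s b
NoUsefulOcc-tySub σ (proj e i t)       h           = NoUsefulOcc-tySub σ t h
NoUsefulOcc-tySub σ (inj e i t)        h           = NoUsefulOcc-tySub σ t h
NoUsefulOcc-tySub σ (case e t P s Q u) (a , b , c) =
  NoUsefulOcc-tySub σ t a , NoUsefulOcc-tySub σ s b , NoUsefulOcc-tySub σ u c
NoUsefulOcc-tySub σ (lam e P t)        h           = NoUsefulOcc-tySub σ t h
NoUsefulOcc-tySub σ (app e t s)        (a , b)     = NoUsefulOcc-tySub σ t a , NoUsefulOcc-tySub σ s b
NoUsefulOcc-tySub σ (copair e t s)     (a , b)     = NoUsefulOcc-tySub σ t a , NoUsefulOcc-tySub σ s b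
NoUsefulOcc-tySub σ (colam e t P Q s)  (a , b)     = NoUsefulOcc-tySub σ t a , NoUsefulOcc-tySub σ s b
NoUsefulOcc-tySub σ (negI e t)         h           = NoUsefulOcc-tySub σ t h
NoUsefulOcc-tySub σ (negE e t)         h           = NoUsefulOcc-tySub σ t h
NoUsefulOcc-tySub σ (tlam e t)         h           = NoUsefulOcc-tySub (textS σ) t h
NoUsefulOcc-tySub σ (tapp e t A)       h           = NoUsefulOcc-tySub σ t h
NoUsefulOcc-tySub σ (pack e A t)       h           = NoUsefulOcc-tySub σ t h
NoUsefulOcc-tySub σ (open′ e t P s)    (a , b)     = NoUsefulOcc-tySub σ t a , NoUsefulOcc-tySub (textS σ) s b

Intuitionistic-tySub : ∀ σ t → Intuitionistic t → Intuitionistic (tySub σ t)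
Intuitionistic-tySub σ (var x)              h           = h
Intuitionistic-tySub σ (abs P t s)          (a , b)     = Intuitionistic-tySub σ t a , Intuitionistic-tySub σ s b
Intuitionistic-tySub σ (wlam pos P t)       (a , b)     = Intuitionistic-tySub σ t a , NoUsefulOcc-tySub σ t b
Intuitionistic-tySub σ (wlam neg P t)       h           = Intuitionistic-tySub σ t h
Intuitionistic-tySub σ (wapp pos t s)       h           = Intuitionistic-tySub σ t h
Intuitionistic-tySub σ (wapp neg t s)       (a , b)     = Intuitionistic-tySub σ t a , Intuitionistic-tySub σ s b
Intuitionistic-tySub σ (pair e t s)         (a , b)     = Intuitionistic-tySub σ t a , Intuitionistic-tySub σ s b
Intuitionistic-tySub σ (proj e i t)         h           = Intuitionistic-tySub σ t h
Intuitionistic-tySub σ (inj e i t)          h           = Intuitionistic-tySub σ t h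
Intuitionistic-tySub σ (case pos t P s Q u) (a , b , c) =
  Intuitionistic-tySub σ t a , Intuitionistic-tySub σ s b , Intuitionistic-tySub σ u c
Intuitionistic-tySub σ (lam e P t)          h           = Intuitionistic-tySub σ t h
Intuitionistic-tySub σ (app e t s)          (a , b)     = Intuitionistic-tySub σ t a , Intuitionistic-tySub σ s b
Intuitionistic-tySub σ (copair e t s)       (a , b)     = Intuitionistic-tySub σ t a , Intuitionistic-tySub σ s b
Intuitionistic-tySub σ (colam pos t P Q s)  (a , b)     = Intuitionistic-tySub σ t a , Intuitionistic-tySub σ s b
Intuitionistic-tySub σ (negI e t)           h           = Intuitionistic-tySub σ t h
Intuitionistic-tySub σ (negE pos t)         h           = Intuitionistic-tySub σ t h
Intuitionistic-tySub σ (tlam e t)           h           = Intuitionistic-tySub (textS σ) t h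
Intuitionistic-tySub σ (tapp e t A)         h           = Intuitionistic-tySub σ t h
Intuitionistic-tySub σ (pack e A t)         h           = Intuitionistic-tySub σ t h
Intuitionistic-tySub σ (open′ pos t P s)    (a , b)     = Intuitionistic-tySub σ t a , Intuitionistic-tySub (textS σ) s b

NoUsefulOcc-tyRen-suc : ∀ {n} t → NoUsefulOcc n t → NoUsefulOcc n (tyRen suc t)
NoUsefulOcc-tyRen-suc {n} t h =
  subst (NoUsefulOcc n) (sym (tyRen≗tySub (λ _ → refl) t)) (NoUsefulOcc-tySub (tvar ∘ suc) t h)

Intuitionistic-tyRen-suc : ∀ t → Intuitionistic t → Intuitionistic (tyRen suc t)
Intuitionistic-tyRen-suc t h =
  subst Intuitionistic (sym (tyRen≗tySub (λ _ → refl) t)) (Intuitionistic-tySub (tvar ∘ suc) t h)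

private
  map₂ᶠ : {A B C : ℕ → Set} → (∀ {x} → B x → C x) → (∀ x → A x ⊎ B x) → ∀ x → A x ⊎ C x
  map₂ᶠ f h x = map₂ f (h x)

extR-avoids : ∀ {ρ n} {B : ℕ → Set} → (∀ x → ρ x ≢ n ⊎ B (suc x)) → ∀ x → extR ρ x ≢ suc n ⊎ B x
extR-avoids h zero = inj₁ λ ()
extR-avoids h (suc x) with h x
... | inj₁ ρx≢n = inj₁ (ρx≢n ∘ suc-injective)
... | inj₂ b    = inj₂ b

NoUsefulOcc-ren : ∀ {ρ n} t → (∀ x → ρ x ≢ n ⊎ NoUsefulOcc x t) → NoUsefulOcc n (ren ρ t)
NoUsefulOcc-ren (var x) h with h x
... | inj₁ ρx≢n = ρx≢n
... | inj₂ x≢x  = ⊥-elim (x≢x refl)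
NoUsefulOcc-ren (abs P t s)        h = NoUsefulOcc-ren t (map₂ᶠ proj₁ h) , NoUsefulOcc-ren s (map₂ᶠ proj₂ h)
NoUsefulOcc-ren (wlam e P t)       h = NoUsefulOcc-ren t (extR-avoids h)
NoUsefulOcc-ren (wapp pos t s)     h = NoUsefulOcc-ren t h
NoUsefulOcc-ren (wapp neg t s)     h = NoUsefulOcc-ren t (map₂ᶠ proj₁ h) , NoUsefulOcc-ren s (map₂ᶠ proj₂ h)
NoUsefulOcc-ren (pair e t s)       h = NoUsefulOcc-ren t (map₂ᶠ proj₁ h) , NoUsefulOcc-ren s (map₂ᶠ proj₂ h)
NoUsefulOcc-ren (proj e i t)       h = NoUsefulOcc-ren t h
NoUsefulOcc-ren (inj e i t)        h = NoUsefulOcc-ren t h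
NoUsefulOcc-ren (case e t P s Q u) h =
  NoUsefulOcc-ren t (map₂ᶠ proj₁ h) ,
  NoUsefulOcc-ren s (extR-avoids (map₂ᶠ (proj₁ ∘ proj₂) h)) ,
  NoUsefulOcc-ren u (extR-avoids (map₂ᶠ (proj₂ ∘ proj₂) h))
NoUsefulOcc-ren (lam e P t)        h = NoUsefulOcc-ren t (extR-avoids h)
NoUsefulOcc-ren (app e t s)        h = NoUsefulOcc-ren t (map₂ᶠ proj₁ h) , NoUsefulOcc-ren s (map₂ᶠ proj₂ h)
NoUsefulOcc-ren (copair e t s)     h = NoUsefulOcc-ren t (map₂ᶠ proj₁ h) , NoUsefulOcc-ren s (map₂ᶠ proj₂ h)
NoUsefulOcc-ren (colam e t P Q s)  h =
  NoUsefulOcc-ren t (map₂ᶠ proj₁ h) , NoUsefulOcc-ren s (extR-avoids (extR-avoids (map₂ᶠ proj₂ h)))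
NoUsefulOcc-ren (negI e t)         h = NoUsefulOcc-ren t h
NoUsefulOcc-ren (negE e t)         h = NoUsefulOcc-ren t h
NoUsefulOcc-ren (tlam e t)         h = NoUsefulOcc-ren t h
NoUsefulOcc-ren (tapp e t A)       h = NoUsefulOcc-ren t h
NoUsefulOcc-ren (pack e A t)       h = NoUsefulOcc-ren t h
NoUsefulOcc-ren (open′ e t P s)    h =
  NoUsefulOcc-ren t (map₂ᶠ proj₁ h) , NoUsefulOcc-ren s (extR-avoids (map₂ᶠ proj₂ h))

NoUsefulOcc-ren-suc : ∀ {n} t → NoUsefulOcc n t → NoUsefulOcc (suc n) (ren suc t)
NoUsefulOcc-ren-suc {n} t h = NoUsefulOcc-ren t avoids
  where
  avoids : ∀ x → suc x ≢ suc n ⊎ NoUsefulOcc x t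
  avoids x with x ≟ n
  ... | yes refl = inj₂ h
  ... | no x≢n   = inj₁ (x≢n ∘ suc-injective)

NoUsefulOcc-zero-ren-suc : ∀ t → NoUsefulOcc zero (ren suc t)
NoUsefulOcc-zero-ren-suc t = NoUsefulOcc-ren t λ _ → inj₁ λ ()

Intuitionistic-ren : ∀ {ρ} t → Intuitionistic t → Intuitionistic (ren ρ t)
Intuitionistic-ren (var x)              h           = tt
Intuitionistic-ren (abs P t s)          (a , b)     = Intuitionistic-ren t a , Intuitionistic-ren s b
Intuitionistic-ren {ρ} (wlam pos P t)   (a , b)     = Intuitionistic-ren t a , NoUsefulOcc-ren t avoids
  where
  avoids : ∀ x → extR ρ x ≢ zero ⊎ NoUsefulOcc x t
  avoids zero    = inj₂ b
  avoids (suc x) = inj₁ λ ()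
Intuitionistic-ren (wlam neg P t)       h           = Intuitionistic-ren t h
Intuitionistic-ren (wapp pos t s)       h           = Intuitionistic-ren t h
Intuitionistic-ren (wapp neg t s)       (a , b)     = Intuitionistic-ren t a , Intuitionistic-ren s b
Intuitionistic-ren (pair e t s)         (a , b)     = Intuitionistic-ren t a , Intuitionistic-ren s b
Intuitionistic-ren (proj e i t)         h           = Intuitionistic-ren t h
Intuitionistic-ren (inj e i t)          h           = Intuitionistic-ren t h
Intuitionistic-ren (case pos t P s Q u) (a , b , c) =
  Intuitionistic-ren t a , Intuitionistic-ren s b , Intuitionistic-ren u c
Intuitionistic-ren (lam e P t)          h           = Intuitionistic-ren t h
Intuitionistic-ren (app e t s)          (a , b)     = Intuitionistic-ren t a , Intuitionistic-ren s b
Intuitionistic-ren (copair e t s)       (a , b)     = Intuitionistic-ren t a , Intuitionistic-ren s b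
Intuitionistic-ren (colam pos t P Q s)  (a , b)     = Intuitionistic-ren t a , Intuitionistic-ren s b
Intuitionistic-ren (negI e t)           h           = Intuitionistic-ren t h
Intuitionistic-ren (negE pos t)         h           = Intuitionistic-ren t h
Intuitionistic-ren (tlam e t)           h           = Intuitionistic-ren t h
Intuitionistic-ren (tapp e t A)         h           = Intuitionistic-ren t h
Intuitionistic-ren (pack e A t)         h           = Intuitionistic-ren t h
Intuitionistic-ren (open′ pos t P s)    (a , b)     = Intuitionistic-ren t a , Intuitionistic-ren s b

extS-avoids : ∀ {σ n} {B : ℕ → Set} →
  (∀ x → NoUsefulOcc n (σ x) ⊎ B (suc x)) → ∀ x → NoUsefulOcc (suc n) (extS σ x) ⊎ B x
extS-avoids h zero = inj₁ λ ()
extS-avoids {σ} h (suc x) = map₁ (NoUsefulOcc-ren-suc (σ x)) (h x)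

tyExtS-avoids : ∀ {σ n} {B : ℕ → Set} →
  (∀ x → NoUsefulOcc n (σ x) ⊎ B x) → ∀ x → NoUsefulOcc n (tyExtS σ x) ⊎ B x
tyExtS-avoids {σ} h x = map₁ (NoUsefulOcc-tyRen-suc (σ x)) (h x)

NoUsefulOcc-sub : ∀ {σ n} t → (∀ x → NoUsefulOcc n (σ x) ⊎ NoUsefulOcc x t) → NoUsefulOcc n (sub σ t)
NoUsefulOcc-sub (var x) h with h x
... | inj₁ σx-avoids = σx-avoids
... | inj₂ x≢x       = ⊥-elim (x≢x refl)
NoUsefulOcc-sub (abs P t s)        h = NoUsefulOcc-sub t (map₂ᶠ proj₁ h) , NoUsefulOcc-sub s (map₂ᶠ proj₂ h)
NoUsefulOcc-sub (wlam e P t)       h = NoUsefulOcc-sub t (extS-avoids h)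
NoUsefulOcc-sub (wapp pos t s)     h = NoUsefulOcc-sub t h
NoUsefulOcc-sub (wapp neg t s)     h = NoUsefulOcc-sub t (map₂ᶠ proj₁ h) , NoUsefulOcc-sub s (map₂ᶠ proj₂ h)
NoUsefulOcc-sub (pair e t s)       h = NoUsefulOcc-sub t (map₂ᶠ proj₁ h) , NoUsefulOcc-sub s (map₂ᶠ proj₂ h)
NoUsefulOcc-sub (proj e i t)       h = NoUsefulOcc-sub t h
NoUsefulOcc-sub (inj e i t)        h = NoUsefulOcc-sub t h
NoUsefulOcc-sub (case e t P s Q u) h =
  NoUsefulOcc-sub t (map₂ᶠ proj₁ h) ,
  NoUsefulOcc-sub s (extS-avoids (map₂ᶠ (proj₁ ∘ proj₂) h)) ,
  NoUsefulOcc-sub u (extS-avoids (map₂ᶠ (proj₂ ∘ proj₂) h))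
NoUsefulOcc-sub (lam e P t)        h = NoUsefulOcc-sub t (extS-avoids h)
NoUsefulOcc-sub (app e t s)        h = NoUsefulOcc-sub t (map₂ᶠ proj₁ h) , NoUsefulOcc-sub s (map₂ᶠ proj₂ h)
NoUsefulOcc-sub (copair e t s)     h = NoUsefulOcc-sub t (map₂ᶠ proj₁ h) , NoUsefulOcc-sub s (map₂ᶠ proj₂ h)
NoUsefulOcc-sub (colam e t P Q s)  h =
  NoUsefulOcc-sub t (map₂ᶠ proj₁ h) , NoUsefulOcc-sub s (extS-avoids (extS-avoids (map₂ᶠ proj₂ h)))
NoUsefulOcc-sub (negI e t)         h = NoUsefulOcc-sub t h
NoUsefulOcc-sub (negE e t)         h = NoUsefulOcc-sub t h
NoUsefulOcc-sub {σ} (tlam e t)     h = NoUsefulOcc-sub t (tyExtS-avoids {σ} h)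
NoUsefulOcc-sub (tapp e t A)       h = NoUsefulOcc-sub t h
NoUsefulOcc-sub (pack e A t)       h = NoUsefulOcc-sub t h
NoUsefulOcc-sub {σ} (open′ e t P s) h =
  NoUsefulOcc-sub t (map₂ᶠ proj₁ h) , NoUsefulOcc-sub s (extS-avoids (tyExtS-avoids {σ} (map₂ᶠ proj₂ h)))

extS-intuitionistic : ∀ {σ} {B : ℕ → Set} →
  (∀ x → Intuitionistic (σ x) ⊎ B (suc x)) → ∀ x → Intuitionistic (extS σ x) ⊎ B x
extS-intuitionistic h zero        = inj₁ tt
extS-intuitionistic {σ} h (suc x) = map₁ (Intuitionistic-ren (σ x)) (h x)

tyExtS-intuitionistic : ∀ {σ} {B : ℕ → Set} →
  (∀ x → Intuitionistic (σ x) ⊎ B x) → ∀ x → Intuitionistic (tyExtS σ x) ⊎ B x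
tyExtS-intuitionistic {σ} h x = map₁ (Intuitionistic-tyRen-suc (σ x)) (h x)

Intuitionistic-sub : ∀ {σ} t → (∀ x → Intuitionistic (σ x) ⊎ NoUsefulOcc x t) →
                     Intuitionistic t → Intuitionistic (sub σ t)
Intuitionistic-sub (var x) h _ with h x
... | inj₁ σx-int = σx-int
... | inj₂ x≢x    = ⊥-elim (x≢x refl)
Intuitionistic-sub (abs P t s) h (a , b) =
  Intuitionistic-sub t (map₂ᶠ proj₁ h) a , Intuitionistic-sub s (map₂ᶠ proj₂ h) b
Intuitionistic-sub {σ} (wlam pos P t) h (a , b) =
  Intuitionistic-sub t (extS-intuitionistic h) a , NoUsefulOcc-sub t avoids
  where
  avoids : ∀ x → NoUsefulOcc zero (extS σ x) ⊎ NoUsefulOcc x t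
  avoids zero    = inj₂ b
  avoids (suc x) = inj₁ (NoUsefulOcc-zero-ren-suc (σ x))
Intuitionistic-sub (wlam neg P t) h a = Intuitionistic-sub t (extS-intuitionistic h) a
Intuitionistic-sub (wapp pos t s) h a = Intuitionistic-sub t h a
Intuitionistic-sub (wapp neg t s) h (a , b) =
  Intuitionistic-sub t (map₂ᶠ proj₁ h) a , Intuitionistic-sub s (map₂ᶠ proj₂ h) b
Intuitionistic-sub (pair e t s) h (a , b) =
  Intuitionistic-sub t (map₂ᶠ proj₁ h) a , Intuitionistic-sub s (map₂ᶠ proj₂ h) b
Intuitionistic-sub (proj e i t) h a = Intuitionistic-sub t h a
Intuitionistic-sub (inj e i t)  h a = Intuitionistic-sub t h a
Intuitionistic-sub (case pos t P s Q u) h (a , b , c) =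
  Intuitionistic-sub t (map₂ᶠ proj₁ h) a ,
  Intuitionistic-sub s (extS-intuitionistic (map₂ᶠ (proj₁ ∘ proj₂) h)) b ,
  Intuitionistic-sub u (extS-intuitionistic (map₂ᶠ (proj₂ ∘ proj₂) h)) c
Intuitionistic-sub (lam e P t) h a = Intuitionistic-sub t (extS-intuitionistic h) a
Intuitionistic-sub (app e t s) h (a , b) =
  Intuitionistic-sub t (map₂ᶠ proj₁ h) a , Intuitionistic-sub s (map₂ᶠ proj₂ h) b
Intuitionistic-sub (copair e t s) h (a , b) =
  Intuitionistic-sub t (map₂ᶠ proj₁ h) a , Intuitionistic-sub s (map₂ᶠ proj₂ h) b
Intuitionistic-sub (colam pos t P Q s) h (a , b) =
  Intuitionistic-sub t (map₂ᶠ proj₁ h) a ,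
  Intuitionistic-sub s (extS-intuitionistic (extS-intuitionistic (map₂ᶠ proj₂ h))) b
Intuitionistic-sub (negI e t)   h a = Intuitionistic-sub t h a
Intuitionistic-sub (negE pos t) h a = Intuitionistic-sub t h a
Intuitionistic-sub {σ} (tlam e t) h a = Intuitionistic-sub t (tyExtS-intuitionistic {σ} h) a
Intuitionistic-sub (tapp e t A) h a = Intuitionistic-sub t h a
Intuitionistic-sub (pack e A t) h a = Intuitionistic-sub t h a
Intuitionistic-sub {σ} (open′ pos t P s) h (a , b) =
  Intuitionistic-sub t (map₂ᶠ proj₁ h) a ,
  Intuitionistic-sub s (extS-intuitionistic (tyExtS-intuitionistic {σ} (map₂ᶠ proj₂ h))) b

single-intuitionistic : ∀ {s} {B : ℕ → Set} → Intuitionistic s → ∀ x → Intuitionistic (single s x) ⊎ B x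
single-intuitionistic a zero    = inj₁ a
single-intuitionistic a (suc x) = inj₁ tt

double-intuitionistic : ∀ {t s} {B : ℕ → Set} →
  Intuitionistic t → Intuitionistic s → ∀ x → Intuitionistic (double t s x) ⊎ B x
double-intuitionistic a b zero          = inj₁ b
double-intuitionistic a b (suc zero)    = inj₁ a
double-intuitionistic a b (suc (suc x)) = inj₁ tt

single-avoids : ∀ {n s} t → NoUsefulOcc n s ⊎ NoUsefulOcc zero t → NoUsefulOcc (suc n) t →
                ∀ x → NoUsefulOcc n (single s x) ⊎ NoUsefulOcc x t
single-avoids t h₀ h zero = h₀
single-avoids {n} t h₀ h (suc x) with x ≟ n
... | yes refl = inj₂ h
... | no x≢n   = inj₁ x≢n

double-avoids : ∀ {n t s} u → NoUsefulOcc n t → NoUsefulOcc n s → NoUsefulOcc (suc (suc n)) u →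
                ∀ x → NoUsefulOcc n (double t s x) ⊎ NoUsefulOcc x u
double-avoids u a b h zero       = inj₁ b
double-avoids u a b h (suc zero) = inj₁ a
double-avoids {n} u a b h (suc (suc x)) with x ≟ n
... | yes refl = inj₂ h
... | no x≢n   = inj₁ x≢n

Intuitionistic-[]ᵐ : ∀ {s} t → Intuitionistic t → Intuitionistic s → Intuitionistic (t [ s ]ᵐ)
Intuitionistic-[]ᵐ t a b = Intuitionistic-sub t (single-intuitionistic b) a

Intuitionistic-[]ᵐ-useless : ∀ {s} t → Intuitionistic t → NoUsefulOcc zero t → Intuitionistic (t [ s ]ᵐ)
Intuitionistic-[]ᵐ-useless t a h = Intuitionistic-sub t unused a
  where
  unused : ∀ x → Intuitionistic (single _ x) ⊎ NoUsefulOcc x t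
  unused zero    = inj₂ h
  unused (suc x) = inj₁ tt

NoUsefulOcc-[]ᵐ : ∀ {n s} t → NoUsefulOcc (suc n) t → NoUsefulOcc n s → NoUsefulOcc n (t [ s ]ᵐ)
NoUsefulOcc-[]ᵐ t h a = NoUsefulOcc-sub t (single-avoids t (inj₁ a) h)

NoUsefulOcc-[]ᵐ-useless : ∀ {n s} t → NoUsefulOcc (suc n) t → NoUsefulOcc zero t → NoUsefulOcc n (t [ s ]ᵐ)
NoUsefulOcc-[]ᵐ-useless t h h₀ = NoUsefulOcc-sub t (single-avoids t (inj₂ h₀) h)

Intuitionistic-[]ᵀ : ∀ A t → Intuitionistic t → Intuitionistic (t [ A ]ᵀ)
Intuitionistic-[]ᵀ A = Intuitionistic-tySub (tsingle A)

NoUsefulOcc-[]ᵀ : ∀ {n} A t → NoUsefulOcc n t → NoUsefulOcc n (t [ A ]ᵀ)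
NoUsefulOcc-[]ᵀ A = NoUsefulOcc-tySub (tsingle A)

-- Intuitionistic terms are closed under reduction

-- In the #-rules the reduct gabs ⊕ Q t s is abs Q (wapp pos t s) (wapp neg s t),
-- so its conditions are those of t, s and t again (dually for gabs ⊖).

↦-preserves-Intuitionistic : ∀ {t s} → t ↦ s → Intuitionistic t → Intuitionistic s
↦-preserves-Intuitionistic (β-weak {e = pos} {t = t}) (a , h) = Intuitionistic-[]ᵐ-useless t a h
↦-preserves-Intuitionistic (β-weak {e = neg} {t = t}) (a , b) = Intuitionistic-[]ᵐ t a b
↦-preserves-Intuitionistic (β-pair {i = i₁}) (a , b) = a
↦-preserves-Intuitionistic (β-pair {i = i₂}) (a , b) = b
↦-preserves-Intuitionistic (β-case {e = pos} {i = i₁} {s₁ = s₁}) (a , b , c) = Intuitionistic-[]ᵐ s₁ b a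
↦-preserves-Intuitionistic (β-case {e = pos} {i = i₂} {s₂ = s₂}) (a , b , c) = Intuitionistic-[]ᵐ s₂ c a
↦-preserves-Intuitionistic (β-lam {t = t}) (a , b) = Intuitionistic-[]ᵐ t a b
↦-preserves-Intuitionistic (β-colam {e = pos} {u = u}) ((a , b) , c) =
  Intuitionistic-sub u (double-intuitionistic a b) c
↦-preserves-Intuitionistic (β-neg {e = pos}) a = a
↦-preserves-Intuitionistic (β-tlam {t = t} {A = A}) a = Intuitionistic-[]ᵀ A t a
↦-preserves-Intuitionistic (β-open {e = pos} {A = A} {s = s}) (a , b) =
  Intuitionistic-[]ᵐ (s [ A ]ᵀ) (Intuitionistic-[]ᵀ A s b) a
↦-preserves-Intuitionistic (#-pair {i = i₁}) ((a , b) , c) = a , c , a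
↦-preserves-Intuitionistic (#-pair {i = i₂}) ((a , b) , c) = b , c , b
↦-preserves-Intuitionistic (#-inj {i = i₁}) (a , b , c) = a , b , a
↦-preserves-Intuitionistic (#-inj {i = i₂}) (a , b , c) = a , c , a
↦-preserves-Intuitionistic (#-lam {t = t}) (a , b , c) =
  let t[s] = Intuitionistic-[]ᵐ t a b in t[s] , c , t[s]
↦-preserves-Intuitionistic (#-colam {u = u}) ((a , b) , c) = b , Intuitionistic-[]ᵐ u c a , b
↦-preserves-Intuitionistic #-neg (a , b) = b , a , b
↦-preserves-Intuitionistic (#-tlam {t = t} {A = A}) (a , b) =
  let t[A] = Intuitionistic-[]ᵀ A t a in t[A] , b , t[A]
↦-preserves-Intuitionistic (#-pack {A = A} {s = s}) (a , b) = a , Intuitionistic-[]ᵀ A s b , a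

↦-preserves-NoUsefulOcc : ∀ {t s} → t ↦ s → ∀ n → Intuitionistic t → NoUsefulOcc n t → NoUsefulOcc n s
↦-preserves-NoUsefulOcc (β-weak {e = pos} {t = t}) n (_ , h₀) h = NoUsefulOcc-[]ᵐ-useless t h h₀
↦-preserves-NoUsefulOcc (β-weak {e = neg} {t = t}) n _ (a , b) = NoUsefulOcc-[]ᵐ t a b
↦-preserves-NoUsefulOcc (β-pair {i = i₁}) n _ (a , b) = a
↦-preserves-NoUsefulOcc (β-pair {i = i₂}) n _ (a , b) = b
↦-preserves-NoUsefulOcc (β-case {e = pos} {i = i₁} {s₁ = s₁}) n _ (a , b , c) = NoUsefulOcc-[]ᵐ s₁ b a
↦-preserves-NoUsefulOcc (β-case {e = pos} {i = i₂} {s₂ = s₂}) n _ (a , b , c) = NoUsefulOcc-[]ᵐ s₂ c a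
↦-preserves-NoUsefulOcc (β-lam {t = t}) n _ (a , b) = NoUsefulOcc-[]ᵐ t a b
↦-preserves-NoUsefulOcc (β-colam {e = pos} {u = u}) n _ ((a , b) , c) =
  NoUsefulOcc-sub u (double-avoids u a b c)
↦-preserves-NoUsefulOcc β-neg n _ a = a
↦-preserves-NoUsefulOcc (β-tlam {t = t} {A = A}) n _ a = NoUsefulOcc-[]ᵀ A t a
↦-preserves-NoUsefulOcc (β-open {e = pos} {A = A} {s = s}) n _ (a , b) =
  NoUsefulOcc-[]ᵐ (s [ A ]ᵀ) (NoUsefulOcc-[]ᵀ A s b) a
↦-preserves-NoUsefulOcc (#-pair {i = i₁}) n _ ((a , b) , c) = a , c , a
↦-preserves-NoUsefulOcc (#-pair {i = i₂}) n _ ((a , b) , c) = b , c , b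
↦-preserves-NoUsefulOcc (#-inj {i = i₁}) n _ (a , b , c) = a , b , a
↦-preserves-NoUsefulOcc (#-inj {i = i₂}) n _ (a , b , c) = a , c , a
↦-preserves-NoUsefulOcc (#-lam {t = t}) n _ (a , b , c) =
  let t[s] = NoUsefulOcc-[]ᵐ t a b in t[s] , c , t[s]
↦-preserves-NoUsefulOcc (#-colam {u = u}) n _ ((a , b) , c) = b , NoUsefulOcc-[]ᵐ u c a , b
↦-preserves-NoUsefulOcc #-neg n _ (a , b) = b , a , b
↦-preserves-NoUsefulOcc (#-tlam {t = t} {A = A}) n _ (a , b) =
  let t[A] = NoUsefulOcc-[]ᵀ A t a in t[A] , b , t[A]
↦-preserves-NoUsefulOcc (#-pack {A = A} {s = s}) n _ (a , b) = a , NoUsefulOcc-[]ᵀ A s b , a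

module _ {t s : Tm}
         (int : Intuitionistic t → Intuitionistic s)
         (nuo : ∀ n → Intuitionistic t → NoUsefulOcc n t → NoUsefulOcc n s) where

  mutual
    Intuitionistic-plug : ∀ C → Intuitionistic (plug C t) → Intuitionistic (plug C s)
    Intuitionistic-plug ∙                     a           = int a
    Intuitionistic-plug (abs₁ _ C _)          (a , b)     = Intuitionistic-plug C a , b
    Intuitionistic-plug (abs₂ _ _ C)          (a , b)     = a , Intuitionistic-plug C b
    Intuitionistic-plug (wlam₁ pos _ C)       (a , b)     = Intuitionistic-plug C a , NoUsefulOcc-plug C 0 a b
    Intuitionistic-plug (wlam₁ neg _ C)       a           = Intuitionistic-plug C a
    Intuitionistic-plug (wapp₁ pos C _)       a           = Intuitionistic-plug C a
    Intuitionistic-plug (wapp₁ neg C _)       (a , b)     = Intuitionistic-plug C a , b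
    Intuitionistic-plug (wapp₂ pos _ C)       a           = a
    Intuitionistic-plug (wapp₂ neg _ C)       (a , b)     = a , Intuitionistic-plug C b
    Intuitionistic-plug (pair₁ _ C _)         (a , b)     = Intuitionistic-plug C a , b
    Intuitionistic-plug (pair₂ _ _ C)         (a , b)     = a , Intuitionistic-plug C b
    Intuitionistic-plug (proj₁′ _ _ C)        a           = Intuitionistic-plug C a
    Intuitionistic-plug (inj₁ _ _ C)          a           = Intuitionistic-plug C a
    Intuitionistic-plug (case₁ pos C _ _ _ _) (a , b , c) = Intuitionistic-plug C a , b , c
    Intuitionistic-plug (case₂ pos _ _ C _ _) (a , b , c) = a , Intuitionistic-plug C b , c
    Intuitionistic-plug (case₃ pos _ _ _ _ C) (a , b , c) = a , b , Intuitionistic-plug C c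
    Intuitionistic-plug (lam₁ _ _ C)          a           = Intuitionistic-plug C a
    Intuitionistic-plug (app₁ _ C _)          (a , b)     = Intuitionistic-plug C a , b
    Intuitionistic-plug (app₂ _ _ C)          (a , b)     = a , Intuitionistic-plug C b
    Intuitionistic-plug (copair₁ _ C _)       (a , b)     = Intuitionistic-plug C a , b
    Intuitionistic-plug (copair₂ _ _ C)       (a , b)     = a , Intuitionistic-plug C b
    Intuitionistic-plug (colam₁ pos C _ _ _)  (a , b)     = Intuitionistic-plug C a , b
    Intuitionistic-plug (colam₂ pos _ _ _ C)  (a , b)     = a , Intuitionistic-plug C b
    Intuitionistic-plug (negI₁ _ C)           a           = Intuitionistic-plug C a
    Intuitionistic-plug (negE₁ pos C)         a           = Intuitionistic-plug C a
    Intuitionistic-plug (tlam₁ _ C)           a           = Intuitionistic-plug C a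
    Intuitionistic-plug (tapp₁ _ C _)         a           = Intuitionistic-plug C a
    Intuitionistic-plug (pack₁ _ _ C)         a           = Intuitionistic-plug C a
    Intuitionistic-plug (open₁ pos C _ _)     (a , b)     = Intuitionistic-plug C a , b
    Intuitionistic-plug (open₂ pos _ _ C)     (a , b)     = a , Intuitionistic-plug C b

    NoUsefulOcc-plug : ∀ C n → Intuitionistic (plug C t) → NoUsefulOcc n (plug C t) → NoUsefulOcc n (plug C s)
    NoUsefulOcc-plug ∙                     n a           h           = nuo n a h
    NoUsefulOcc-plug (abs₁ _ C _)          n (a , _)     (h , k)     = NoUsefulOcc-plug C n a h , k
    NoUsefulOcc-plug (abs₂ _ _ C)          n (_ , b)     (h , k)     = h , NoUsefulOcc-plug C n b k
    NoUsefulOcc-plug (wlam₁ pos _ C)       n (a , _)     h           = NoUsefulOcc-plug C (suc n) a h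
    NoUsefulOcc-plug (wlam₁ neg _ C)       n a           h           = NoUsefulOcc-plug C (suc n) a h
    NoUsefulOcc-plug (wapp₁ pos C _)       n a           h           = NoUsefulOcc-plug C n a h
    NoUsefulOcc-plug (wapp₁ neg C _)       n (a , _)     (h , k)     = NoUsefulOcc-plug C n a h , k
    NoUsefulOcc-plug (wapp₂ pos _ C)       n _           h           = h
    NoUsefulOcc-plug (wapp₂ neg _ C)       n (_ , b)     (h , k)     = h , NoUsefulOcc-plug C n b k
    NoUsefulOcc-plug (pair₁ _ C _)         n (a , _)     (h , k)     = NoUsefulOcc-plug C n a h , k
    NoUsefulOcc-plug (pair₂ _ _ C)         n (_ , b)     (h , k)     = h , NoUsefulOcc-plug C n b k
    NoUsefulOcc-plug (proj₁′ _ _ C)        n a           h           = NoUsefulOcc-plug C n a h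
    NoUsefulOcc-plug (inj₁ _ _ C)          n a           h           = NoUsefulOcc-plug C n a h
    NoUsefulOcc-plug (case₁ pos C _ _ _ _) n (a , _ , _) (h , k , l) = NoUsefulOcc-plug C n a h , k , l
    NoUsefulOcc-plug (case₂ pos _ _ C _ _) n (_ , b , _) (h , k , l) = h , NoUsefulOcc-plug C (suc n) b k , l
    NoUsefulOcc-plug (case₃ pos _ _ _ _ C) n (_ , _ , c) (h , k , l) = h , k , NoUsefulOcc-plug C (suc n) c l
    NoUsefulOcc-plug (lam₁ _ _ C)          n a           h           = NoUsefulOcc-plug C (suc n) a h
    NoUsefulOcc-plug (app₁ _ C _)          n (a , _)     (h , k)     = NoUsefulOcc-plug C n a h , k
    NoUsefulOcc-plug (app₂ _ _ C)          n (_ , b)     (h , k)     = h , NoUsefulOcc-plug C n b k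
    NoUsefulOcc-plug (copair₁ _ C _)       n (a , _)     (h , k)     = NoUsefulOcc-plug C n a h , k
    NoUsefulOcc-plug (copair₂ _ _ C)       n (_ , b)     (h , k)     = h , NoUsefulOcc-plug C n b k
    NoUsefulOcc-plug (colam₁ pos C _ _ _)  n (a , _)     (h , k)     = NoUsefulOcc-plug C n a h , k
    NoUsefulOcc-plug (colam₂ pos _ _ _ C)  n (_ , b)     (h , k)     = h , NoUsefulOcc-plug C (suc (suc n)) b k
    NoUsefulOcc-plug (negI₁ _ C)           n a           h           = NoUsefulOcc-plug C n a h
    NoUsefulOcc-plug (negE₁ pos C)         n a           h           = NoUsefulOcc-plug C n a h
    NoUsefulOcc-plug (tlam₁ _ C)           n a           h           = NoUsefulOcc-plug C n a h
    NoUsefulOcc-plug (tapp₁ _ C _)         n a           h           = NoUsefulOcc-plug C n a h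
    NoUsefulOcc-plug (pack₁ _ _ C)         n a           h           = NoUsefulOcc-plug C n a h
    NoUsefulOcc-plug (open₁ pos C _ _)     n (a , _)     (h , k)     = NoUsefulOcc-plug C n a h , k
    NoUsefulOcc-plug (open₂ pos _ _ C)     n (_ , b)     (h , k)     = h , NoUsefulOcc-plug C (suc n) b k

proposition8 : ∀ {Γ : Ctx} {t s : Tm} {P : MTy} → Γ ⊢PRJ t ⦂ P → t ⟶ s → Γ ⊢PRJ s ⦂ P
proposition8 (⊢t , int-t) (step C t↦s) =
  ⊢-plug (↦-preserves-⊢ t↦s) C ⊢t ,
  Intuitionistic-plug (↦-preserves-Intuitionistic t↦s) (↦-preserves-NoUsefulOcc t↦s) C int-t
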